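{- There exist absolute constants $C>0$ and $\alpha\ge 0$ (independent of $p$ and $A$) such that the following holds. Let $p$ be a prime, let $\mathbb{F}_p$ be the field with $p$ elements, and let $A\subset \mathbb{F}_p$ satisfy $2\le |A| < p^{1/2}$. Then $$|A|^{14/13} \le C(\log |A|)^{\alpha}\,\max\big(|AA|,\,|A+A|\big),$$ where $A+A=\{a+b: a,b\in A\}$ and $AA=\{ab: a,b\in A\}$. In the paper's notation: $\max(|AA|,|A+A|)\gtrapprox |A|^{14/13}$.
   Context: For a finite set $B$, $|B|$ denotes its cardinality. The paper writes $X\lessapprox Y$ to mean $X\le C(\log|A|)^{\alpha}Y$ for absolute constants $C,\alpha$, and $X\gtrapprox Y$ for $Y\lessapprox X$. -}

module Defs where

open import Data.Nat using (ℕ; NonZero; _+_; _*_; _⊔_)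
open import Data.Nat.DivMod using (_mod_)
open import Data.Fin using (Fin; toℕ)
open import Data.Fin.Properties using (any?) renaming (_≟_ to _≟ᶠ_)
open import Data.Fin.Subset using (Subset; ∣_∣)
open import Data.Fin.Subset.Properties using (_∈?_)
open import Data.Vec using (tabulate)
open import Relation.Nullary using (does)
open import Relation.Nullary.Decidable using (_×-dec_)
open import Data.Product using (_,_)

module _ {p : ℕ} .{{_ : NonZero p}} where

  _+ₚ_ : Fin p → Fin p → Fin p
  a +ₚ b = (toℕ a + toℕ b) mod p

  _*ₚ_ : Fin p → Fin p → Fin p
  a *ₚ b = (toℕ a * toℕ b) mod p

  sumset : Subset p → Subset p
  sumset A = tabulate λ z →
    does (any? λ a → any? λ b → (a ∈? A) ×-dec ((b ∈? A) ×-dec ((a +ₚ b) ≟ᶠ z)))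

  prodset : Subset p → Subset p
  prodset A = tabulate λ z →
    does (any? λ a → any? λ b → (a ∈? A) ×-dec ((b ∈? A) ×-dec ((a *ₚ b) ≟ᶠ z)))

  sumProdMax : Subset p → ℕ
  sumProdMax A = ∣ prodset A ∣ ⊔ ∣ sumset A ∣

{-# OPTIONS --safe #-}

-- Write n = |A| with 0 removed and S = max(|AA|, |A+A|).  By Cauchy–Schwarz and a dyadic
-- pigeonhole there are b ∈ A, N and B ⊆ A with |aA ∩ bA| ≥ N for a ∈ B and
-- n³ ≤ S (1 + log n) N |B|.  Since aA and bA share N points, bA ± aA has O(S²/N) elements, so by
-- Plünnecke's inequality |zA − wA + xA − yA| = O(S⁸/(n³N⁴)) for x, y, z, w ∈ B.  Conversely, some
-- r = (x − y)/(z − w) satisfies |B|³ ≤ 4 |B+B| |B+rB|: if the ratio set R of B is all of 𝔽ₚ, an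
-- average over r gives |B+rB| ≥ |B|²/2; otherwise R contains r with r+1 ∉ R, so the sums
-- x + (r+1)y are distinct for x, y ∈ B, and Petridis' argument bounds |X+B+rB| for some X ⊆ B.
-- As (z − w)(B + rB) ⊆ zA − wA + xA − yA, the two estimates give n³N⁴|B|³ = O(S⁹).
module Submission where

open import Defs
open import Algebra.Bundles using (AbelianGroup; CommutativeRing)
open import Algebra.Core using (Op₁; Op₂)
import Algebra.Properties.AbelianGroup as AbelianGroupProperties
import Algebra.Properties.Ring as RingProperties
open import Algebra.Structures using (IsAbelianGroup; IsCommutativeRing)
open import Data.Bool using (if_then_else_)
open import Data.Fin using (Fin; zero; suc; toℕ)
open import Data.Fin.Properties
  using (any?; suc-injective; 0≢1+n; toℕ<n; toℕ-injective; toℕ-fromℕ<)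
  renaming (_≟_ to _≟ᶠ_)
open import Data.Fin.Subset
open import Data.Fin.Subset.Properties
open import Data.Nat hiding (∣_-_∣)
open import Data.Nat.DivMod
open import Data.Nat.Divisibility using (∣⇒≤; m%n≡0⇒n∣m) renaming (_∣_ to _divides_)
open import Data.Nat.Induction using (<-rec)
open import Data.Nat.Logarithm using (⌈log₂_⌉; ⌈log₂⌈n/2⌉⌉≡⌈log₂n⌉∸1; ⌈log₂⌉-mono-≤)
open import Data.Nat.Primality using (Prime; euclidsLemma)
open import Data.Nat.Properties hiding (suc-injective; 0≢1+n)
open import Algebra.Properties.Semiring.Sum +-*-semiring
  using (sum; sum-cong-≗; ∑-comm; ∑-distrib-+; *-distribˡ-sum; *-distribʳ-sum)
open import Data.Nat.Tactic.RingSolver using (solve-∀)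
open import Data.Product using (Σ; ∃; _×_; _,_; proj₁; proj₂)
open import Data.Sum using (_⊎_; inj₁; inj₂)
import Data.Sum as Sum
open import Data.Vec using (tabulate; []; _∷_; here; there)
open import Data.Vec.Properties using (lookup∘tabulate; []=⇒lookup; lookup⇒[]=)
open import Function using (_∘_; id)
open import Relation.Binary.PropositionalEquality
open import Relation.Nullary
open import Relation.Nullary.Decidable using (_×-dec_; dec-true; decidable-stable; ¬?)
open import Relation.Unary using (Decidable)

-- Counting in finite sets

-- What is proved is the 13th power of the claim, so that all quantities are natural numbers; ratios
-- are cross-multiplied throughout. Energy controls only the product N|B|, neither factor alone. So
-- the fourth power of its lower bound is set against n³N⁴|B|³ = O(S⁹); the surplus factor |B| is at
-- most n, which leaves n¹⁴ against S⁴S⁹ = S¹³, with the logarithm to the power 4. Two demands on r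
-- conflict: r must lie in R, so that B + rB can be moved into a sum of four dilates of A, yet a
-- large sumset is immediate only for multipliers outside R. A pair r, r + 1 on the boundary of R
-- meets both, because (r + 1)B ⊆ B + rB. Such a pair exists unless R is everything, since 0 ∈ R and
-- 1 generates 𝔽ₚ additively; and if R is everything, the r found by averaging lies in R for free.
-- The averaging is where |A|² < p enters.

setOf : ∀ {n} {P : Fin n → Set} → Decidable P → Subset n
setOf P? = tabulate (does ∘ P?)

∈-setOf⁺ : ∀ {n} {P : Fin n → Set} (P? : Decidable P) {x} → P x → x ∈ setOf P?
∈-setOf⁺ P? {x} px = lookup⇒[]= x _ (trans (lookup∘tabulate (does ∘ P?) x) (dec-true (P? x) px))

∈-setOf⁻ : ∀ {n} {P : Fin n → Set} (P? : Decidable P) {x} → x ∈ setOf P? → P x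
∈-setOf⁻ P? {x} x∈ with P? x | trans (sym (lookup∘tabulate (does ∘ P?) x)) ([]=⇒lookup x∈)
... | yes px | _ = px

module _ {m n k : ℕ} (f : Fin m → Fin n → Fin k) where

  image₂? : ∀ A B → Decidable λ z → ∃ λ a → ∃ λ b → a ∈ A × b ∈ B × f a b ≡ z
  image₂? A B z = any? λ a → any? λ b → (a ∈? A) ×-dec ((b ∈? B) ×-dec (f a b ≟ᶠ z))

  image₂ : Subset m → Subset n → Subset k
  image₂ A B = setOf (image₂? A B)

  ∈-image₂⁺ : ∀ {A B a b} → a ∈ A → b ∈ B → f a b ∈ image₂ A B
  ∈-image₂⁺ {A} {B} a∈ b∈ = ∈-setOf⁺ (image₂? A B) (_ , _ , a∈ , b∈ , refl)

  ∈-image₂⁻ : ∀ {A B z} → z ∈ image₂ A B → ∃ λ a → ∃ λ b → a ∈ A × b ∈ B × f a b ≡ z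
  ∈-image₂⁻ {A} {B} = ∈-setOf⁻ (image₂? A B)

-- Induction on `Z`: each element uses up its image, which is deleted from `X` before the rest is
-- counted.
card-injection : ∀ {m n} (Z : Subset m) (X : Subset n) (g : Fin m → Fin n) →
  (∀ {z} → z ∈ Z → g z ∈ X) →
  (∀ {z w} → z ∈ Z → w ∈ Z → g z ≡ g w → z ≡ w) → ∣ Z ∣ ≤ ∣ X ∣
card-injection [] X g g∈ inj = z≤n
card-injection (outside ∷ Z) X g g∈ inj =
  card-injection Z X (g ∘ suc) (g∈ ∘ there) λ z∈ w∈ e → suc-injective (inj (there z∈) (there w∈) e)
card-injection (inside ∷ Z) X g g∈ inj = ≤-trans
  (s≤s (card-injection Z (X - g zero) (g ∘ suc)
    (λ z∈ → x∈p∧x≢y⇒x∈p-y (g∈ (there z∈)) λ e → 0≢1+n (inj here (there z∈) (sym e)))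
    λ z∈ w∈ e → suc-injective (inj (there z∈) (there w∈) e)))
  (x∈p⇒∣p-x∣<∣p∣ (g∈ here))

*-distrib-^ : ∀ m n k → (m * n) ^ k ≡ m ^ k * n ^ k
*-distrib-^ m n zero = refl
*-distrib-^ m n (suc k) =
  trans (cong (m * n *_) (*-distrib-^ m n k)) (interchange m n (m ^ k) (n ^ k))
  where
  interchange : ∀ a b c d → a * b * (c * d) ≡ a * c * (b * d)
  interchange = solve-∀

card-∪-∩ : ∀ {n} (S T : Subset n) → ∣ S ∪ T ∣ + ∣ S ∩ T ∣ ≡ ∣ S ∣ + ∣ T ∣
card-∪-∩ [] [] = refl
card-∪-∩ (outside ∷ S) (outside ∷ T) = card-∪-∩ S T
card-∪-∩ (outside ∷ S) (inside ∷ T) = trans (cong suc (card-∪-∩ S T)) (sym (+-suc _ _))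
card-∪-∩ (inside ∷ S) (outside ∷ T) = cong suc (card-∪-∩ S T)
card-∪-∩ (inside ∷ S) (inside ∷ T) =
  cong suc (trans (+-suc _ _) (trans (cong suc (card-∪-∩ S T)) (sym (+-suc _ _))))

subset-induction : ∀ {n} (P : Subset n → Set) → P ⊥ →
  (∀ c S → P S → P (⁅ c ⁆ ∪ S)) → ∀ S → P S
subset-induction P p⊥ step [] = p⊥
subset-induction P p⊥ step (outside ∷ S) =
  subset-induction (P ∘ (outside ∷_)) p⊥ (λ c T → step (suc c) (outside ∷ T)) S
subset-induction P p⊥ step (inside ∷ S) =
  -- `⁅ zero ⁆ ∪ (outside ∷ S)` computes to `inside ∷ (⊥ ∪ S)`, so only the tail needs rewriting.
  subst (P ∘ (inside ∷_)) (∪-identityˡ S)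
    (step zero (outside ∷ S)
      (subset-induction (P ∘ (outside ∷_)) p⊥ (λ c T → step (suc c) (outside ∷ T)) S))

-- Indicator sums and averaging

χ : ∀ {n} → Subset n → Fin n → ℕ
χ A x = if does (x ∈? A) then 1 else 0

χ-∈ : ∀ {n} {A : Subset n} {x} → x ∈ A → χ A x ≡ 1
χ-∈ {A = A} {x} x∈ rewrite dec-true (x ∈? A) x∈ = refl

χ-mono : ∀ {m n} {A : Subset m} {B : Subset n} {x y} → (x ∈ A → y ∈ B) → χ A x ≤ χ B y
χ-mono {A = A} {x = x} imp with x ∈? A
... | no _ = z≤n
... | yes x∈ = ≤-reflexive (sym (χ-∈ (imp x∈)))

sum-mono-≤ : ∀ {n} {f g : Fin n → ℕ} → (∀ i → f i ≤ g i) → sum f ≤ sum g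
sum-mono-≤ {zero} le = z≤n
sum-mono-≤ {suc n} le = +-mono-≤ (le zero) (sum-mono-≤ (le ∘ suc))

sum-χ : ∀ {n} (A : Subset n) → sum (χ A) ≡ ∣ A ∣
sum-χ [] = refl
sum-χ (outside ∷ A) = sum-χ A
sum-χ (inside ∷ A) = cong suc (sum-χ A)

-- Weighting by the indicator keeps every sum over the whole of `Fin n`, so linearity and exchange
-- of summation come from the library sums.
sumOver : ∀ {n} → Subset n → (Fin n → ℕ) → ℕ
sumOver A f = sum λ a → χ A a * f a

sumOver-mono-≤ : ∀ {n} (A : Subset n) {f g : Fin n → ℕ} →
  (∀ {a} → a ∈ A → f a ≤ g a) → sumOver A f ≤ sumOver A g
sumOver-mono-≤ A le = sum-mono-≤ λ a → pointwise a
  where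
  pointwise : ∀ a → χ A a * _ ≤ χ A a * _
  pointwise a with a ∈? A
  ... | no _ = z≤n
  ... | yes a∈ = *-monoʳ-≤ 1 (le a∈)

sumOver-cong : ∀ {n} (A : Subset n) {f g : Fin n → ℕ} →
  (∀ a → f a ≡ g a) → sumOver A f ≡ sumOver A g
sumOver-cong A eq = sum-cong-≗ λ a → cong (χ A a *_) (eq a)

sumOver-const : ∀ {n} (A : Subset n) c → sumOver A (λ _ → c) ≡ ∣ A ∣ * c
sumOver-const A c = trans (sym (*-distribʳ-sum c (χ A))) (cong (_* c) (sum-χ A))

*-distribˡ-sumOver : ∀ {n} c (A : Subset n) f → c * sumOver A f ≡ sumOver A (λ a → c * f a)
*-distribˡ-sumOver c A f = trans (*-distribˡ-sum c λ a → χ A a * f a)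
  (sum-cong-≗ λ a → rearrange c (χ A a) (f a))
  where
  rearrange : ∀ x y z → x * (y * z) ≡ y * (x * z)
  rearrange = solve-∀

*-distribʳ-sumOver : ∀ {n} c (A : Subset n) f → sumOver A f * c ≡ sumOver A (λ a → f a * c)
*-distribʳ-sumOver c A f = trans (*-distribʳ-sum c λ a → χ A a * f a)
  (sum-cong-≗ λ a → *-assoc (χ A a) (f a) c)

sumOver-distrib-+ : ∀ {n} (A : Subset n) f g →
  sumOver A (λ a → f a + g a) ≡ sumOver A f + sumOver A g
sumOver-distrib-+ A f g = trans (sum-cong-≗ λ a → *-distribˡ-+ (χ A a) (f a) (g a))
  (∑-distrib-+ (λ a → χ A a * f a) (λ a → χ A a * g a))

sum-sumOver-comm : ∀ {m n} (B : Subset n) (f : Fin m → Fin n → ℕ) →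
  sum (λ a → sumOver B (f a)) ≡ sumOver B (λ b → sum λ a → f a b)
sum-sumOver-comm B f = trans (∑-comm λ a b → χ B b * f a b)
  (sum-cong-≗ λ b → sym (*-distribˡ-sum (χ B b) λ a → f a b))

sumOver-comm : ∀ {m n} (A : Subset m) (B : Subset n) (f : Fin m → Fin n → ℕ) →
  sumOver A (λ a → sumOver B (f a)) ≡ sumOver B (λ b → sumOver A λ a → f a b)
sumOver-comm A B f =
  trans (sum-cong-≗ λ a → *-distribˡ-sumOver (χ A a) B (f a))
        (sum-sumOver-comm B λ a b → χ A a * f a b)

sumOver-χ : ∀ {m n} (A : Subset m) (P : Subset n) (g : Fin m → Fin n) (S : Subset m) →
  (∀ {x} → x ∈ A → g x ∈ P → x ∈ S) → sumOver A (χ P ∘ g) ≤ ∣ S ∣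
sumOver-χ A P g S sub = ≤-trans (sum-mono-≤ pointwise) (≤-reflexive (sum-χ S))
  where
  pointwise : ∀ a → χ A a * χ P (g a) ≤ χ S a
  pointwise a with a ∈? A
  ... | no _ = z≤n
  ... | yes a∈ = ≤-trans (≤-reflexive (+-identityʳ _)) (χ-mono {A = P} {B = S} (sub a∈))

sumOver-χ-injective : ∀ {m n} (A : Subset m) (P : Subset n) (g : Fin m → Fin n) →
  (∀ {x y} → g x ≡ g y → x ≡ y) → sumOver A (χ P ∘ g) ≤ ∣ P ∣
sumOver-χ-injective A P g inj =
  ≤-trans (sumOver-χ A P g (setOf λ x → g x ∈? P) λ _ → ∈-setOf⁺ λ x → g x ∈? P)
          (card-injection _ P g (∈-setOf⁻ λ x → g x ∈? P) λ _ _ → inj)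

card≤sumOver-χ : ∀ {n} (A P S : Subset n) → S ⊆ A → S ⊆ P → ∣ S ∣ ≤ sumOver A (χ P)
card≤sumOver-χ A P S S⊆A S⊆P = ≤-trans (≤-reflexive (sym (sum-χ S))) (sum-mono-≤ pointwise)
  where
  pointwise : ∀ a → χ S a ≤ χ A a * χ P a
  pointwise a with a ∈? S
  ... | no _ = z≤n
  ... | yes a∈ rewrite χ-∈ (S⊆A a∈) | χ-∈ (S⊆P a∈) = ≤-refl

card-filter≤ : ∀ {m n} (A : Subset m) (P : Subset n) (g : Fin m → Fin n) →
  ∣ setOf (λ x → (x ∈? A) ×-dec (g x ∈? P)) ∣ ≤ sumOver A (χ P ∘ g)
card-filter≤ A P g = ≤-trans (≤-reflexive (sym (sum-χ V))) (sum-mono-≤ pointwise)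
  where
  V? = λ x → (x ∈? A) ×-dec (g x ∈? P)
  V = setOf V?
  pointwise : ∀ x → χ V x ≤ χ A x * χ P (g x)
  pointwise x with x ∈? V
  ... | no _ = z≤n
  ... | yes x∈ rewrite χ-∈ (proj₁ (∈-setOf⁻ V? x∈)) | χ-∈ (proj₂ (∈-setOf⁻ V? x∈)) = ≤-refl

0<card : ∀ {n} {A : Subset n} {x} → x ∈ A → 0 < ∣ A ∣
0<card {x = x} x∈ = ≤-trans (≤-reflexive (sym (∣⁅x⁆∣≡1 x)))
  (p⊆q⇒∣p∣≤∣q∣ λ y∈ → subst (_∈ _) (sym (x∈⁅y⁆⇒x≡y x y∈)) x∈)

card-Empty : ∀ {n} {A : Subset n} → Empty A → ∣ A ∣ ≡ 0
card-Empty {n} empty = trans (cong ∣_∣ (Empty-unique empty)) (∣⊥∣≡0 n)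

-- The search for `b` is decidable, so only its failure needs an argument: if every |A| f(b) fell
-- short of the total T by at least 1, summing over A would give |A|T + |A| ≤ |A|T.
averaging-max : ∀ {n} (A : Subset n) (f : Fin n → ℕ) → 0 < ∣ A ∣ →
  ∃ λ b → b ∈ A × sumOver A f ≤ ∣ A ∣ * f b
averaging-max A f 0<A with any? (λ b → (b ∈? A) ×-dec (sumOver A f ≤? ∣ A ∣ * f b))
... | yes r = r
... | no ¬r = contradiction bad (<⇒≱ (m<m+n (∣ A ∣ * T) 0<A))
  where
  T = sumOver A f
  open ≤-Reasoning
  bad : ∣ A ∣ * T + ∣ A ∣ ≤ ∣ A ∣ * T
  bad = begin
    ∣ A ∣ * T + ∣ A ∣ ≡⟨ cong₂ _+_ (*-distribˡ-sumOver ∣ A ∣ A f)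
                        (trans (sym (*-identityʳ _)) (sym (sumOver-const A 1))) ⟩
    sumOver A (λ a → ∣ A ∣ * f a) + sumOver A (λ _ → 1)
      ≡⟨ sym (sumOver-distrib-+ A _ _) ⟩
    sumOver A (λ a → ∣ A ∣ * f a + 1)
      ≤⟨ sumOver-mono-≤ A (λ {a} a∈ → subst (_≤ T) (+-comm 1 _) (≰⇒> λ le → ¬r (a , a∈ , le))) ⟩
    sumOver A (λ _ → T) ≡⟨ sumOver-const A T ⟩
    ∣ A ∣ * T ∎

averaging-min : ∀ {n} (A : Subset n) (f : Fin n → ℕ) → 0 < ∣ A ∣ →
  ∃ λ b → b ∈ A × ∣ A ∣ * f b ≤ sumOver A f
averaging-min A f 0<A with any? (λ b → (b ∈? A) ×-dec (∣ A ∣ * f b ≤? sumOver A f))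
... | yes r = r
... | no ¬r = contradiction bad (<⇒≱ (m<m+n (∣ A ∣ * T) 0<A))
  where
  T = sumOver A f
  open ≤-Reasoning
  bad : ∣ A ∣ * T + ∣ A ∣ ≤ ∣ A ∣ * T
  bad = begin
    ∣ A ∣ * T + ∣ A ∣ ≡⟨ rearrange ∣ A ∣ T ⟩
    ∣ A ∣ * suc T ≡⟨ sym (sumOver-const A _) ⟩
    sumOver A (λ _ → suc T)
      ≤⟨ sumOver-mono-≤ A (λ {a} a∈ → ≰⇒> λ le → ¬r (a , a∈ , le)) ⟩
    sumOver A (λ a → ∣ A ∣ * f a) ≡⟨ sym (*-distribˡ-sumOver ∣ A ∣ A f) ⟩
    ∣ A ∣ * T ∎
    where
    rearrange : ∀ x y → x * y + x ≡ x * (1 + y)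
    rearrange = solve-∀

-- Cauchy-Schwarz and the dyadic pigeonhole

2xy≤x²+y² : ∀ x y → 2 * (x * y) ≤ x * x + y * y
2xy≤x²+y² x y with ≤-total x y
... | inj₁ x≤y with d , refl ← m≤n⇒∃[o]m+o≡n x≤y = ≤-trans (m≤m+n _ (d * d)) (≤-reflexive (eq x d))
  where
  eq : ∀ x d → 2 * (x * (x + d)) + d * d ≡ x * x + (x + d) * (x + d)
  eq = solve-∀
... | inj₂ y≤x with d , refl ← m≤n⇒∃[o]m+o≡n y≤x = ≤-trans (m≤m+n _ (d * d)) (≤-reflexive (eq y d))
  where
  eq : ∀ y d → 2 * ((y + d) * y) + d * d ≡ (y + d) * (y + d) + y * y
  eq = solve-∀

-- The square is expanded as a double sum and 2 r(z) r(w) ≤ r(z)² + r(w)² is used termwise, which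
-- avoids subtraction in ℕ.
cauchy-schwarz : ∀ {n} (U : Subset n) (r : Fin n → ℕ) →
  sumOver U r * sumOver U r ≤ ∣ U ∣ * sumOver U (λ z → r z * r z)
cauchy-schwarz U r = *-cancelˡ-≤ 2 (begin
  2 * (T * T) ≡⟨ cong (2 *_) (trans (*-distribʳ-sumOver T U r)
                   (sumOver-cong U λ z → *-distribˡ-sumOver (r z) U r)) ⟩
  2 * sumOver U (λ z → sumOver U λ w → r z * r w)
    ≡⟨ trans (*-distribˡ-sumOver 2 U _) (sumOver-cong U λ z → *-distribˡ-sumOver 2 U _) ⟩
  sumOver U (λ z → sumOver U λ w → 2 * (r z * r w))
    ≤⟨ sumOver-mono-≤ U (λ {z} _ → sumOver-mono-≤ U λ {w} _ → 2xy≤x²+y² (r z) (r w)) ⟩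
  sumOver U (λ z → sumOver U λ w → r z * r z + r w * r w)
    ≡⟨ sumOver-cong U (λ z → trans (sumOver-distrib-+ U _ _)
         (cong (_+ Q) (sumOver-const U (r z * r z)))) ⟩
  sumOver U (λ z → ∣ U ∣ * (r z * r z) + Q)
    ≡⟨ trans (sumOver-distrib-+ U _ _)
         (cong₂ _+_ (sym (*-distribˡ-sumOver ∣ U ∣ U _)) (sumOver-const U Q)) ⟩
  ∣ U ∣ * Q + ∣ U ∣ * Q ≡⟨ cong (∣ U ∣ * Q +_) (sym (+-identityʳ _)) ⟩
  2 * (∣ U ∣ * Q) ∎)
  where
  T = sumOver U r
  Q = sumOver U λ z → r z * r z
  open ≤-Reasoning

-- Let r(z) be the number of indices a with z ∈ G(a). Its sum over U is the total size of the
-- family, and its second moment counts overlaps of pairs. Applied to the dilates aA inside AA and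
-- to the translates ξy + X inside X + ξB.
cauchy-schwarz-family : ∀ {k n} (I : Subset k) (G : Fin k → Subset n) (U : Subset n) →
  (∀ {a} → a ∈ I → G a ⊆ U) →
  sumOver I (λ a → ∣ G a ∣) * sumOver I (λ a → ∣ G a ∣) ≤
  ∣ U ∣ * sumOver I (λ a → sumOver I λ b → ∣ G a ∩ G b ∣)
cauchy-schwarz-family I G U G⊆U = begin
  T * T ≤⟨ *-mono-≤ T≤ T≤ ⟩
  sumOver U r * sumOver U r ≤⟨ cauchy-schwarz U r ⟩
  ∣ U ∣ * sumOver U (λ z → r z * r z) ≤⟨ *-monoʳ-≤ ∣ U ∣ Q≤ ⟩
  ∣ U ∣ * sumOver I (λ a → sumOver I λ b → ∣ G a ∩ G b ∣) ∎
  where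
  open ≤-Reasoning
  T = sumOver I λ a → ∣ G a ∣
  r : Fin _ → ℕ
  r z = sumOver I λ a → χ (G a) z
  T≤ : T ≤ sumOver U r
  T≤ = begin
    T ≤⟨ sumOver-mono-≤ I (λ {a} a∈ → card≤sumOver-χ U (G a) (G a) (G⊆U a∈) id) ⟩
    sumOver I (λ a → sumOver U (χ (G a))) ≡⟨ sumOver-comm I U _ ⟩
    sumOver U r ∎
  χχ≤χ∩ : ∀ a b z → χ (G a) z * χ (G b) z ≤ χ (G a ∩ G b) z
  χχ≤χ∩ a b z with z ∈? G a
  ... | no _ = z≤n
  ... | yes z∈ = ≤-trans (≤-reflexive (+-identityʳ _))
                   (χ-mono {A = G b} {B = G a ∩ G b} λ z∈′ → x∈p∩q⁺ (z∈ , z∈′))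
  χU≤1 : ∀ z → χ U z ≤ 1
  χU≤1 z with z ∈? U
  ... | no _ = z≤n
  ... | yes _ = ≤-refl
  Q≤ : sumOver U (λ z → r z * r z) ≤ sumOver I (λ a → sumOver I λ b → ∣ G a ∩ G b ∣)
  Q≤ = begin
    sumOver U (λ z → r z * r z)
      ≤⟨ sum-mono-≤ (λ z → ≤-trans (*-monoˡ-≤ _ (χU≤1 z)) (≤-reflexive (+-identityʳ _))) ⟩
    sum (λ z → r z * r z)
      ≡⟨ sum-cong-≗ (λ z → trans (*-distribʳ-sumOver (r z) I _)
           (sumOver-cong I λ a → *-distribˡ-sumOver (χ (G a) z) I _)) ⟩
    sum (λ z → sumOver I λ a → sumOver I λ b → χ (G a) z * χ (G b) z)
      ≡⟨ trans (sum-sumOver-comm I λ z a → sumOver I λ b → χ (G a) z * χ (G b) z)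
           (sumOver-cong I λ a → sum-sumOver-comm I λ z b → χ (G a) z * χ (G b) z) ⟩
    sumOver I (λ a → sumOver I λ b → sum λ z → χ (G a) z * χ (G b) z)
      ≤⟨ sumOver-mono-≤ I (λ {a} _ → sumOver-mono-≤ I λ {b} _ →
           ≤-trans (sum-mono-≤ (χχ≤χ∩ a b)) (≤-reflexive (sum-χ (G a ∩ G b)))) ⟩
    sumOver I (λ a → sumOver I λ b → ∣ G a ∩ G b ∣) ∎

-- The bound `c` is charged at `y` as well, which gives |B| c in place of (|B| - 1) c and saves a
-- case distinction.
sumOver-diagonal : ∀ {n} (B : Subset n) (g : Fin n → ℕ) y {c d} →
  g y ≤ d → (∀ {w} → w ∈ B → w ≢ y → g w ≤ c) → sumOver B g ≤ d + ∣ B ∣ * c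
sumOver-diagonal B g y {c} {d} gy≤d g≤c = begin
  sumOver B g ≤⟨ sumOver-mono-≤ B (λ {w} → pointwise w) ⟩
  sumOver B (λ w → χ ⁅ y ⁆ w * d + c) ≡⟨ sumOver-distrib-+ B _ _ ⟩
  sumOver B (λ w → χ ⁅ y ⁆ w * d) + sumOver B (λ _ → c)
    ≡⟨ cong₂ _+_ (sym (*-distribʳ-sumOver d B (χ ⁅ y ⁆))) (sumOver-const B c) ⟩
  sumOver B (χ ⁅ y ⁆) * d + ∣ B ∣ * c
    ≤⟨ +-monoˡ-≤ (∣ B ∣ * c) (≤-trans (*-monoˡ-≤ d
         (≤-trans (sumOver-χ-injective B ⁅ y ⁆ id id) (≤-reflexive (∣⁅x⁆∣≡1 y))))
         (≤-reflexive (+-identityʳ d))) ⟩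
  d + ∣ B ∣ * c ∎
  where
  open ≤-Reasoning
  pointwise : ∀ w → w ∈ B → g w ≤ χ ⁅ y ⁆ w * d + c
  pointwise w w∈ with w ≟ᶠ y
  ... | no w≢y = ≤-trans (g≤c w∈ w≢y) (m≤n+m c _)
  ... | yes refl rewrite χ-∈ (x∈⁅x⁆ y) = ≤-trans gy≤d (≤-trans (m≤m+n d 0) (m≤m+n _ c))

superlevel : ∀ {n} (A : Subset n) (f : Fin n → ℕ) (t : ℕ) → Subset n
superlevel A f t = setOf λ a → (a ∈? A) ×-dec (t ≤? f a)

-- Strip the top binary digit of `h`. A digit 2^j present at `a` forces 2^j ≤ h(a) ≤ f(a), so the
-- total is at most the sum over j < L of 2^j times the size of the superlevel set at 2^j; the
-- largest term wins. `h` loses digits along the recursion while the superlevel sets stay those of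
-- the fixed `f`.
dyadic-pigeonhole : ∀ {n} (A : Subset n) (f : Fin n → ℕ) L (h : Fin n → ℕ) →
  (∀ a → h a ≤ f a) → (∀ a → h a < 2 ^ L) →
  ∃ λ j → sumOver A h ≤ L * (2 ^ j * ∣ superlevel A f (2 ^ j) ∣)
dyadic-pigeonhole A f zero h h≤f h<1 = 0 , (begin
  sumOver A h ≤⟨ sumOver-mono-≤ A (λ {a} _ → ≤-pred (h<1 a)) ⟩
  sumOver A (λ _ → 0) ≡⟨ trans (sumOver-const A 0) (*-zeroʳ ∣ A ∣) ⟩
  0 ∎)
  where open ≤-Reasoning
dyadic-pigeonhole A f (suc L) h h≤f h<2^ = choose (dyadic-pigeonhole A f L (proj₁ ∘ lower)
    (λ a → ≤-trans (proj₁ (proj₂ (lower a))) (h≤f a)) (λ a → proj₁ (proj₂ (proj₂ (lower a)))))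
  where
  open ≤-Reasoning
  V? = λ a → (a ∈? A) ×-dec (2 ^ L ≤? f a)
  V = superlevel A f (2 ^ L)
  lower : ∀ a → ∃ λ l → l ≤ h a × l < 2 ^ L × (a ∈ A → h a ≤ l + 2 ^ L * χ V a)
  lower a with 2 ^ L ≤? h a
  ... | no lt = h a , ≤-refl , ≰⇒> lt , λ _ → m≤m+n _ _
  ... | yes le = h a ∸ 2 ^ L , m∸n≤m (h a) (2 ^ L) ,
      +-cancelʳ-< (2 ^ L) _ _ (subst₂ _<_ (sym (m∸n+n≡m le)) (cong (2 ^ L +_) (+-identityʳ _)) (h<2^ a)) ,
      λ a∈ → ≤-reflexive (trans (sym (m∸n+n≡m le)) (cong (h a ∸ 2 ^ L +_)
        (sym (trans (cong (2 ^ L *_) (χ-∈ (∈-setOf⁺ V? (a∈ , ≤-trans le (h≤f a))))) (*-identityʳ _)))))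
  l : Fin _ → ℕ
  l = proj₁ ∘ lower
  T : ℕ → ℕ
  T j = 2 ^ j * ∣ superlevel A f (2 ^ j) ∣
  split : sumOver A h ≤ T L + sumOver A l
  split = begin
    sumOver A h ≤⟨ sumOver-mono-≤ A (λ {a} → proj₂ (proj₂ (proj₂ (lower a)))) ⟩
    sumOver A (λ a → l a + 2 ^ L * χ V a) ≡⟨ sumOver-distrib-+ A _ _ ⟩
    sumOver A l + sumOver A (λ a → 2 ^ L * χ V a)
      ≡⟨ cong (sumOver A l +_) (sym (*-distribˡ-sumOver (2 ^ L) A (χ V))) ⟩
    sumOver A l + 2 ^ L * sumOver A (χ V)
      ≤⟨ +-monoʳ-≤ (sumOver A l) (*-monoʳ-≤ (2 ^ L) (sumOver-χ-injective A V id id)) ⟩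
    sumOver A l + T L ≡⟨ +-comm _ (T L) ⟩
    T L + sumOver A l ∎
  choose : (∃ λ j → sumOver A l ≤ L * T j) → ∃ λ j → sumOver A h ≤ suc L * T j
  choose (j , le) with ≤-total (T L) (T j)
  ... | inj₁ TL≤Tj = j , ≤-trans split (+-mono-≤ TL≤Tj le)
  ... | inj₂ Tj≤TL = L , ≤-trans split (+-monoʳ-≤ (T L) (≤-trans le (*-monoʳ-≤ L Tj≤TL)))

-- Plünnecke and Ruzsa inequalities

-- A section of `h`, found by search, is injective on `Z` because `h` undoes it.
card-surjection : ∀ {n} (Z X : Subset n) (h : Fin n → Fin n) →
  (∀ {z} → z ∈ Z → ∃ λ x → x ∈ X × h x ≡ z) → ∣ Z ∣ ≤ ∣ X ∣
card-surjection Z X h pre = card-injection Z X section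
  (λ z∈ → proj₁ (section-spec z∈))
  λ z∈ w∈ e → trans (sym (proj₂ (section-spec z∈))) (trans (cong h e) (proj₂ (section-spec w∈)))
  where
  section : Fin _ → Fin _
  section z with any? (λ x → (x ∈? X) ×-dec (h x ≟ᶠ z))
  ... | yes (x , _) = x
  ... | no _ = z
  section-spec : ∀ {z} → z ∈ Z → section z ∈ X × h (section z) ≡ z
  section-spec {z} z∈ with any? (λ x → (x ∈? X) ×-dec (h x ≟ᶠ z))
  ... | yes (_ , spec) = spec
  ... | no ¬pre = contradiction (pre z∈) ¬pre

⊆∧⊉⇒⊂ : ∀ {n} {Z Y : Subset n} → Z ⊆ Y → ¬ (Y ⊆ Z) → Z ⊂ Y
⊆∧⊉⇒⊂ {Z = Z} {Y} Z⊆Y Y⊈Z with any? (λ x → (x ∈? Y) ×-dec ¬? (x ∈? Z))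
... | yes w = Z⊆Y , w
... | no ¬w = contradiction (λ {x} x∈Y → decidable-stable (x ∈? Z) λ x∉Z → ¬w (x , x∈Y , x∉Z)) Y⊈Z

card-∪-≤ : ∀ {n} (S T : Subset n) → ∣ S ∪ T ∣ ≤ ∣ S ∣ + ∣ T ∣
card-∪-≤ S T = ≤-trans (m≤m+n _ ∣ S ∩ T ∣) (≤-reflexive (card-∪-∩ S T))

module _ {n : ℕ} (F : Subset n → ℕ) where

  -- F(X)/|X| ≤ F(Z)/|Z| without division; the empty Z satisfies it trivially.
  RatioMinimal : Subset n → Set
  RatioMinimal X = ∀ {Z} → Z ⊆ X → F X * ∣ Z ∣ ≤ F Z * ∣ X ∣

  -- Either Y is itself minimal, or some Z ⊆ Y has strictly smaller ratio. Such a Z is nonempty and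
  -- proper, so induction on |Y| continues inside Z, and the comparisons of ratios compose.
  ratio-minimizer : ∀ Y → 0 < ∣ Y ∣ →
    ∃ λ X → X ⊆ Y × 0 < ∣ X ∣ × F X * ∣ Y ∣ ≤ F Y * ∣ X ∣ × RatioMinimal X
  ratio-minimizer Y = <-rec Goal step ∣ Y ∣ Y refl
    where
    Goal : ℕ → Set
    Goal k = ∀ Y → ∣ Y ∣ ≡ k → 0 < ∣ Y ∣ →
      ∃ λ X → X ⊆ Y × 0 < ∣ X ∣ × F X * ∣ Y ∣ ≤ F Y * ∣ X ∣ × RatioMinimal X
    shrink : ∀ {k} → (∀ {j} → j < k → Goal j) → ∀ Y Z → ∣ Y ∣ ≡ k →
      Z ⊆ Y → F Z * ∣ Y ∣ < F Y * ∣ Z ∣ →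
      ∃ λ X → X ⊆ Y × 0 < ∣ X ∣ × F X * ∣ Y ∣ ≤ F Y * ∣ X ∣ × RatioMinimal X
    shrink rec Y Z refl Z⊆Y lt =
      let X , X⊆Z , 0<X , le , min = rec (p⊂q⇒∣p∣<∣q∣ (⊆∧⊉⇒⊂ Z⊆Y Y⊈Z)) Z refl 0<Z
      in X , Z⊆Y ∘ X⊆Z , 0<X , *-cancelʳ-≤ _ _ ∣ Z ∣ {{>-nonZero 0<Z}} (begin
        F X * ∣ Y ∣ * ∣ Z ∣ ≡⟨ swap (F X) ∣ Y ∣ ∣ Z ∣ ⟩
        F X * ∣ Z ∣ * ∣ Y ∣ ≤⟨ *-monoˡ-≤ ∣ Y ∣ le ⟩
        F Z * ∣ X ∣ * ∣ Y ∣ ≡⟨ swap (F Z) ∣ X ∣ ∣ Y ∣ ⟩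
        F Z * ∣ Y ∣ * ∣ X ∣ ≤⟨ *-monoˡ-≤ ∣ X ∣ (<⇒≤ lt) ⟩
        F Y * ∣ Z ∣ * ∣ X ∣ ≡⟨ swap (F Y) ∣ Z ∣ ∣ X ∣ ⟩
        F Y * ∣ X ∣ * ∣ Z ∣ ∎) , min
      where
      Y⊈Z : ¬ (Y ⊆ Z)
      Y⊈Z Y⊆Z = <-irrefl (cong (λ T → F T * ∣ Y ∣) Z≡Y) (subst (λ T → F Z * ∣ Y ∣ < F Y * ∣ T ∣) Z≡Y lt)
        where
        Z≡Y = ⊆-antisym Z⊆Y Y⊆Z
      0<Z : 0 < ∣ Z ∣
      0<Z = n≢0⇒n>0 λ e → n≮0 (subst (F Z * ∣ Y ∣ <_) (trans (cong (F Y *_) e) (*-zeroʳ (F Y))) lt)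
      swap : ∀ x y z → x * y * z ≡ x * z * y
      swap = solve-∀
      open ≤-Reasoning
    step : ∀ k → (∀ {j} → j < k → Goal j) → Goal k
    step k rec Y eq 0<Y
      with anySubset? (λ Z → (Z ⊆? Y) ×-dec (F Z * ∣ Y ∣ <? F Y * ∣ Z ∣))
    ... | no ¬smaller =
      Y , id , 0<Y , ≤-refl , λ {Z} Z⊆Y → ≮⇒≥ λ lt → ¬smaller (Z , Z⊆Y , lt)
    ... | yes (Z , Z⊆Y , lt) = shrink rec Y Z eq Z⊆Y lt

module Additive {p : ℕ} (_⊞_ : Op₂ (Fin p)) (0# : Fin p) (⊟_ : Op₁ (Fin p))
  (isAbelianGroup : IsAbelianGroup _≡_ _⊞_ 0# ⊟_) where

  infixl 6 _⊕_

  private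
    𝔾 : AbelianGroup _ _
    𝔾 = record { isAbelianGroup = isAbelianGroup }
    module 𝔾 = AbelianGroup 𝔾
    open AbelianGroupProperties 𝔾

  _⊕_ : Op₂ (Subset p)
  _⊕_ = image₂ _⊞_

  ⊕⁺ : ∀ {A B a b} → a ∈ A → b ∈ B → a ⊞ b ∈ A ⊕ B
  ⊕⁺ {A} {B} = ∈-image₂⁺ _⊞_ {A} {B}

  ⊕⁻ : ∀ A B {z} → z ∈ A ⊕ B → ∃ λ a → ∃ λ b → a ∈ A × b ∈ B × a ⊞ b ≡ z
  ⊕⁻ A B = ∈-image₂⁻ _⊞_ {A} {B}

  ⊕-mono : ∀ {A A′ B B′} → A ⊆ A′ → B ⊆ B′ → A ⊕ B ⊆ A′ ⊕ B′
  ⊕-mono {A} {A′} {B} {B′} A⊆ B⊆ z∈ with _ , _ , a∈ , b∈ , refl ← ⊕⁻ A B z∈ =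
    ⊕⁺ (A⊆ a∈) (B⊆ b∈)

  ⊕-comm-⊆ : ∀ A B → A ⊕ B ⊆ B ⊕ A
  ⊕-comm-⊆ A B z∈ with a , b , a∈ , b∈ , refl ← ⊕⁻ A B z∈ =
    subst (_∈ B ⊕ A) (𝔾.comm b a) (⊕⁺ b∈ a∈)

  ⊕-comm : ∀ A B → A ⊕ B ≡ B ⊕ A
  ⊕-comm A B = ⊆-antisym (⊕-comm-⊆ A B) (⊕-comm-⊆ B A)

  ⊕-assoc : ∀ A B C → (A ⊕ B) ⊕ C ≡ A ⊕ (B ⊕ C)
  ⊕-assoc A B C = ⊆-antisym to from
    where
    to : (A ⊕ B) ⊕ C ⊆ A ⊕ (B ⊕ C)
    to z∈ with _ , c , ab∈ , c∈ , refl ← ⊕⁻ (A ⊕ B) C z∈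
          with a , b , a∈ , b∈ , refl ← ⊕⁻ A B ab∈ =
      subst (_∈ A ⊕ (B ⊕ C)) (sym (𝔾.assoc a b c)) (⊕⁺ a∈ (⊕⁺ b∈ c∈))
    from : A ⊕ (B ⊕ C) ⊆ (A ⊕ B) ⊕ C
    from z∈ with a , _ , a∈ , bc∈ , refl ← ⊕⁻ A (B ⊕ C) z∈
            with b , c , b∈ , c∈ , refl ← ⊕⁻ B C bc∈ =
      subst (_∈ (A ⊕ B) ⊕ C) (𝔾.assoc a b c) (⊕⁺ (⊕⁺ a∈ b∈) c∈)

  ⊥⊕ : ∀ B → ⊥ ⊕ B ≡ ⊥
  ⊥⊕ B = ⊆-antisym (λ z∈ → contradiction (proj₁ (proj₂ (proj₂ (⊕⁻ ⊥ B z∈)))) ∉⊥) ⊥⊆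

  ⊕-∪-⊆ : ∀ A S T → A ⊕ (S ∪ T) ⊆ (A ⊕ S) ∪ (A ⊕ T)
  ⊕-∪-⊆ A S T z∈ with _ , _ , a∈ , b∈ , refl ← ⊕⁻ A (S ∪ T) z∈ with x∈p∪q⁻ S T b∈
  ... | inj₁ b∈S = x∈p∪q⁺ (inj₁ (⊕⁺ a∈ b∈S))
  ... | inj₂ b∈T = x∈p∪q⁺ (inj₂ (⊕⁺ a∈ b∈T))

  ⊕-∪ : ∀ A S T → A ⊕ (S ∪ T) ≡ (A ⊕ S) ∪ (A ⊕ T)
  ⊕-∪ A S T = ⊆-antisym (⊕-∪-⊆ A S T) from
    where
    from : (A ⊕ S) ∪ (A ⊕ T) ⊆ A ⊕ (S ∪ T)
    from z∈ with x∈p∪q⁻ (A ⊕ S) (A ⊕ T) z∈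
    ... | inj₁ z∈S = ⊕-mono {A} {A} {S} id (x∈p∪q⁺ ∘ inj₁) z∈S
    ... | inj₂ z∈T = ⊕-mono {A} {A} {T} id (x∈p∪q⁺ ∘ inj₂) z∈T

  card-⊕-∪ : ∀ A S T → ∣ A ⊕ (S ∪ T) ∣ ≤ ∣ A ⊕ S ∣ + ∣ A ⊕ T ∣
  card-⊕-∪ A S T = ≤-trans (p⊆q⇒∣p∣≤∣q∣ (⊕-∪-⊆ A S T)) (card-∪-≤ (A ⊕ S) (A ⊕ T))

  card≤⊕ˡ : ∀ {A} B {x} → x ∈ A → ∣ B ∣ ≤ ∣ A ⊕ B ∣
  card≤⊕ˡ {A} B {x} x∈ = card-injection B (A ⊕ B) (x ⊞_) (⊕⁺ x∈) λ _ _ → ∙-cancelˡ x _ _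

  card≤⊕ : ∀ A B → 0 < ∣ A ∣ → ∣ B ∣ ≤ ∣ A ⊕ B ∣
  card≤⊕ A B 0<A with nonempty? A
  ... | yes (_ , x∈) = card≤⊕ˡ B x∈
  ... | no empty = contradiction (subst (0 <_) (card-Empty empty) 0<A) n≮0

  card-translate : ∀ c X → ∣ ⁅ c ⁆ ⊕ X ∣ ≡ ∣ X ∣
  card-translate c X = ≤-antisym
    (card-surjection (⁅ c ⁆ ⊕ X) X (c ⊞_) pre)
    (card≤⊕ˡ X (x∈⁅x⁆ c))
    where
    pre : ∀ {z} → z ∈ ⁅ c ⁆ ⊕ X → ∃ λ x → x ∈ X × c ⊞ x ≡ z
    pre z∈ with _ , x , c∈ , x∈ , refl ← ⊕⁻ ⁅ c ⁆ X z∈ with refl ← x∈⁅y⁆⇒x≡y c c∈ = x , x∈ , refl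

  -- The properties of X ↦ ∣ X ⊕ B ∣ used in Petridis' argument; unlike that function they are
  -- stable under positive linear combinations, which treats several summands B at once.
  record Submodular (F : Subset p → ℕ) : Set where
    field
      F⊥ : F ⊥ ≡ 0
      submodular : ∀ S T W c → W ⊆ T → ⁅ c ⁆ ⊕ W ⊆ S →
        F (S ∪ (⁅ c ⁆ ⊕ T)) + F W ≤ F S + F T

  -- Inclusion-exclusion for S + B and c + T + B: their union is the sumset of S ∪ (c + T) with B,
  -- and their intersection contains c + W + B since c + W ⊆ S and W ⊆ T.
  card-⊕-submodular : ∀ B → Submodular λ X → ∣ X ⊕ B ∣
  card-⊕-submodular B = record
    { F⊥ = trans (cong ∣_∣ (⊥⊕ B)) (∣⊥∣≡0 p)
    ; submodular = sub
    }
    where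
    sub : ∀ S T W c → W ⊆ T → ⁅ c ⁆ ⊕ W ⊆ S →
      ∣ (S ∪ (⁅ c ⁆ ⊕ T)) ⊕ B ∣ + ∣ W ⊕ B ∣ ≤ ∣ S ⊕ B ∣ + ∣ T ⊕ B ∣
    sub S T W c W⊆T cW⊆S = begin
      ∣ (S ∪ (⁅ c ⁆ ⊕ T)) ⊕ B ∣ + ∣ W ⊕ B ∣
        ≡⟨ cong₂ _+_ (cong ∣_∣ distrib) (sym (card-translate c (W ⊕ B))) ⟩
      ∣ P ∪ Q ∣ + ∣ ⁅ c ⁆ ⊕ (W ⊕ B) ∣
        ≤⟨ +-monoʳ-≤ ∣ P ∪ Q ∣ (p⊆q⇒∣p∣≤∣q∣ λ z∈ →
             x∈p∩q⁺ (inP z∈ , ⊕-mono {⁅ c ⁆} id (⊕-mono {W} {T} {B} W⊆T id) z∈)) ⟩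
      ∣ P ∪ Q ∣ + ∣ P ∩ Q ∣ ≡⟨ card-∪-∩ P Q ⟩
      ∣ P ∣ + ∣ Q ∣ ≡⟨ cong (∣ P ∣ +_) (card-translate c (T ⊕ B)) ⟩
      ∣ S ⊕ B ∣ + ∣ T ⊕ B ∣ ∎
      where
      open ≤-Reasoning
      P = S ⊕ B
      Q = ⁅ c ⁆ ⊕ (T ⊕ B)
      distrib : (S ∪ (⁅ c ⁆ ⊕ T)) ⊕ B ≡ P ∪ Q
      distrib = trans (⊕-comm _ B) (trans (⊕-∪ B S (⁅ c ⁆ ⊕ T))
        (cong₂ _∪_ (⊕-comm B S) (trans (⊕-comm B _) (⊕-assoc ⁅ c ⁆ T B))))
      inP : ⁅ c ⁆ ⊕ (W ⊕ B) ⊆ P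
      inP z∈ = ⊕-mono {⁅ c ⁆ ⊕ W} {S} {B} cW⊆S id (subst (_ ∈_) (sym (⊕-assoc ⁅ c ⁆ W B)) z∈)

  combination-submodular : ∀ {F G} u v → Submodular F → Submodular G →
    Submodular λ X → u * F X + v * G X
  combination-submodular {F} {G} u v sF sG = record
    { F⊥ = cong₂ _+_ (trans (cong (u *_) (F⊥ sF)) (*-zeroʳ u))
                     (trans (cong (v *_) (F⊥ sG)) (*-zeroʳ v))
    ; submodular = λ S T W c W⊆ cW⊆ →
        let S′ = S ∪ (⁅ c ⁆ ⊕ T) in begin
        u * F S′ + v * G S′ + (u * F W + v * G W) ≡⟨ rearrange u v (F S′) (G S′) (F W) (G W) ⟩
        u * (F S′ + F W) + v * (G S′ + G W)
          ≤⟨ +-mono-≤ (*-monoʳ-≤ u (submodular sF S T W c W⊆ cW⊆))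
                      (*-monoʳ-≤ v (submodular sG S T W c W⊆ cW⊆)) ⟩
        u * (F S + F T) + v * (G S + G T) ≡⟨ sym (rearrange u v (F S) (G S) (F T) (G T)) ⟩
        u * F S + v * G S + (u * F T + v * G T) ∎
    }
    where
    open Submodular
    open ≤-Reasoning
    rearrange : ∀ u v a b c d → u * a + v * b + (u * c + v * d) ≡ u * (a + c) + v * (b + d)
    rearrange = solve-∀

  -- When c is added to C, let W be the part of X that c carries into X + C. Submodularity lets F
  -- grow by at most F(X) - F(W), while the cardinality grows by at least |X| - |W|. Minimality
  -- gives F(W) ≥ F(X)|W|/|X|, so the increment also has ratio at most F(X)/|X|.
  petridis : ∀ {F} → Submodular F → ∀ X → RatioMinimal F X →
    ∀ C → F (X ⊕ C) * ∣ X ∣ ≤ F X * ∣ X ⊕ C ∣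
  petridis {F} sF X min = subset-induction _ base step
    where
    open Submodular sF
    open ≤-Reasoning
    base : F (X ⊕ ⊥) * ∣ X ∣ ≤ F X * ∣ X ⊕ ⊥ ∣
    base rewrite ⊕-comm X ⊥ | ⊥⊕ X | F⊥ = z≤n
    step : ∀ c C → F (X ⊕ C) * ∣ X ∣ ≤ F X * ∣ X ⊕ C ∣ →
      F (X ⊕ (⁅ c ⁆ ∪ C)) * ∣ X ∣ ≤ F X * ∣ X ⊕ (⁅ c ⁆ ∪ C) ∣
    step c C ih = subst (λ Z → F Z * ∣ X ∣ ≤ F X * ∣ Z ∣) (sym split)
      (+-cancelʳ-≤ (F X * ∣ W ∣) _ _ (begin
        F S′ * ∣ X ∣ + F X * ∣ W ∣ ≤⟨ +-monoʳ-≤ (F S′ * ∣ X ∣) (min W⊆X) ⟩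
        F S′ * ∣ X ∣ + F W * ∣ X ∣ ≡⟨ sym (*-distribʳ-+ ∣ X ∣ (F S′) (F W)) ⟩
        (F S′ + F W) * ∣ X ∣ ≤⟨ *-monoˡ-≤ ∣ X ∣ (submodular S X W c W⊆X cW⊆S) ⟩
        (F S + F X) * ∣ X ∣ ≡⟨ *-distribʳ-+ ∣ X ∣ (F S) (F X) ⟩
        F S * ∣ X ∣ + F X * ∣ X ∣ ≤⟨ +-monoˡ-≤ (F X * ∣ X ∣) ih ⟩
        F X * ∣ S ∣ + F X * ∣ X ∣ ≡⟨ sym (*-distribˡ-+ (F X) ∣ S ∣ ∣ X ∣) ⟩
        F X * (∣ S ∣ + ∣ X ∣) ≤⟨ *-monoʳ-≤ (F X) count ⟩
        F X * (∣ S′ ∣ + ∣ W ∣) ≡⟨ *-distribˡ-+ (F X) ∣ S′ ∣ ∣ W ∣ ⟩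
        F X * ∣ S′ ∣ + F X * ∣ W ∣ ∎))
      where
      S = X ⊕ C
      S′ = S ∪ (⁅ c ⁆ ⊕ X)
      W? = λ x → (x ∈? X) ×-dec ((c ⊞ x) ∈? S)
      W = setOf W?
      W⊆X : W ⊆ X
      W⊆X = proj₁ ∘ ∈-setOf⁻ W?
      cW⊆S : ⁅ c ⁆ ⊕ W ⊆ S
      cW⊆S z∈ with _ , _ , c∈ , x∈ , refl ← ⊕⁻ ⁅ c ⁆ W z∈ with refl ← x∈⁅y⁆⇒x≡y c c∈ =
        proj₂ (∈-setOf⁻ W? x∈)
      split : X ⊕ (⁅ c ⁆ ∪ C) ≡ S′
      split = trans (⊕-∪ X ⁅ c ⁆ C) (trans (∪-comm _ _) (cong (S ∪_) (⊕-comm X ⁅ c ⁆)))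
      S∩cX⊆cW : S ∩ (⁅ c ⁆ ⊕ X) ⊆ ⁅ c ⁆ ⊕ W
      S∩cX⊆cW z∈ with z∈S , z∈cX ← x∈p∩q⁻ S (⁅ c ⁆ ⊕ X) z∈
                 with _ , _ , c∈ , x∈ , refl ← ⊕⁻ ⁅ c ⁆ X z∈cX
                 with refl ← x∈⁅y⁆⇒x≡y c c∈ = ⊕⁺ c∈ (∈-setOf⁺ W? (x∈ , z∈S))
      count : ∣ S ∣ + ∣ X ∣ ≤ ∣ S′ ∣ + ∣ W ∣
      count = begin
        ∣ S ∣ + ∣ X ∣ ≡⟨ cong (∣ S ∣ +_) (sym (card-translate c X)) ⟩
        ∣ S ∣ + ∣ ⁅ c ⁆ ⊕ X ∣ ≡⟨ sym (card-∪-∩ S (⁅ c ⁆ ⊕ X)) ⟩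
        ∣ S′ ∣ + ∣ S ∩ (⁅ c ⁆ ⊕ X) ∣
          ≤⟨ +-monoʳ-≤ ∣ S′ ∣ (≤-trans (p⊆q⇒∣p∣≤∣q∣ S∩cX⊆cW) (≤-reflexive (card-translate c W))) ⟩
        ∣ S′ ∣ + ∣ W ∣ ∎

  infixr 7 _×ˢ_
  -- The k-fold sumset B + ... + B, not a dilate.
  _×ˢ_ : ℕ → Subset p → Subset p
  zero ×ˢ B = ⁅ 0# ⁆
  suc k ×ˢ B = B ⊕ (k ×ˢ B)

  -- Let X ⊆ Y minimise K = |X+B|/|X|. Petridis with C = jB gives |X+(j+1)B| ≤ K|X+jB|, hence |kB| ≤
  -- |X+kB| ≤ K^k |X|, and K ≤ |Y+B|/|Y|.
  plünnecke : ∀ k Y B → 0 < ∣ Y ∣ → ∣ Y ∣ ^ k * ∣ k ×ˢ B ∣ ≤ ∣ Y ⊕ B ∣ ^ k * ∣ Y ∣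
  plünnecke k Y B 0<Y
    with X , X⊆Y , 0<X , ratio , min ← ratio-minimizer (λ X → ∣ X ⊕ B ∣) Y 0<Y =
    *-cancelʳ-≤ _ _ (∣ X ∣ ^ k) {{m^n≢0 ∣ X ∣ k {{>-nonZero 0<X}}}} (begin
      ∣ Y ∣ ^ k * ∣ k ×ˢ B ∣ * ∣ X ∣ ^ k
        ≤⟨ *-monoˡ-≤ (∣ X ∣ ^ k) (*-monoʳ-≤ (∣ Y ∣ ^ k) (card≤⊕ X (k ×ˢ B) 0<X)) ⟩
      ∣ Y ∣ ^ k * ∣ X ⊕ k ×ˢ B ∣ * ∣ X ∣ ^ k ≡⟨ *-assoc (∣ Y ∣ ^ k) _ _ ⟩
      ∣ Y ∣ ^ k * (∣ X ⊕ k ×ˢ B ∣ * ∣ X ∣ ^ k) ≤⟨ *-monoʳ-≤ (∣ Y ∣ ^ k) (iterate k) ⟩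
      ∣ Y ∣ ^ k * (∣ X ⊕ B ∣ ^ k * ∣ X ∣) ≡⟨ eq₁ (∣ Y ∣ ^ k) (∣ X ⊕ B ∣ ^ k) ∣ X ∣ ⟩
      ∣ X ⊕ B ∣ ^ k * ∣ Y ∣ ^ k * ∣ X ∣ ≡⟨ cong (_* ∣ X ∣) (sym (*-distrib-^ (∣ X ⊕ B ∣) (∣ Y ∣) k)) ⟩
      (∣ X ⊕ B ∣ * ∣ Y ∣) ^ k * ∣ X ∣ ≤⟨ *-mono-≤ (^-monoˡ-≤ k ratio) (p⊆q⇒∣p∣≤∣q∣ X⊆Y) ⟩
      (∣ Y ⊕ B ∣ * ∣ X ∣) ^ k * ∣ Y ∣ ≡⟨ cong (_* ∣ Y ∣) (*-distrib-^ (∣ Y ⊕ B ∣) (∣ X ∣) k) ⟩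
      ∣ Y ⊕ B ∣ ^ k * ∣ X ∣ ^ k * ∣ Y ∣ ≡⟨ swap (∣ Y ⊕ B ∣ ^ k) (∣ X ∣ ^ k) ∣ Y ∣ ⟩
      ∣ Y ⊕ B ∣ ^ k * ∣ Y ∣ * ∣ X ∣ ^ k ∎)
    where
    open ≤-Reasoning
    eq₁ : ∀ a b c → a * (b * c) ≡ b * a * c
    eq₁ = solve-∀
    swap : ∀ x y z → x * y * z ≡ x * z * y
    swap = solve-∀
    eq₂ : ∀ a b c → a * (b * c) ≡ a * b * c
    eq₂ = solve-∀
    iterate : ∀ j → ∣ X ⊕ j ×ˢ B ∣ * ∣ X ∣ ^ j ≤ ∣ X ⊕ B ∣ ^ j * ∣ X ∣
    iterate zero = ≤-reflexive (trans (*-identityʳ _) (trans (cong ∣_∣ (⊕-comm X ⁅ 0# ⁆))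
      (trans (card-translate 0# X) (sym (+-identityʳ _)))))
    iterate (suc j) = begin
      ∣ X ⊕ (B ⊕ j ×ˢ B) ∣ * (∣ X ∣ * ∣ X ∣ ^ j)
        ≡⟨ eq₂ (∣ X ⊕ (B ⊕ j ×ˢ B) ∣) (∣ X ∣) (∣ X ∣ ^ j) ⟩
      ∣ X ⊕ (B ⊕ j ×ˢ B) ∣ * ∣ X ∣ * ∣ X ∣ ^ j
        ≡⟨ cong (λ Z → ∣ Z ∣ * ∣ X ∣ * ∣ X ∣ ^ j)
             (trans (cong (X ⊕_) (⊕-comm B (j ×ˢ B))) (sym (⊕-assoc X (j ×ˢ B) B))) ⟩
      ∣ (X ⊕ j ×ˢ B) ⊕ B ∣ * ∣ X ∣ * ∣ X ∣ ^ j
        ≤⟨ *-monoˡ-≤ (∣ X ∣ ^ j) (petridis (card-⊕-submodular B) X min (j ×ˢ B)) ⟩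
      ∣ X ⊕ B ∣ * ∣ X ⊕ j ×ˢ B ∣ * ∣ X ∣ ^ j ≡⟨ *-assoc ∣ X ⊕ B ∣ _ _ ⟩
      ∣ X ⊕ B ∣ * (∣ X ⊕ j ×ˢ B ∣ * ∣ X ∣ ^ j) ≤⟨ *-monoʳ-≤ ∣ X ⊕ B ∣ (iterate j) ⟩
      ∣ X ⊕ B ∣ * (∣ X ⊕ B ∣ ^ j * ∣ X ∣) ≡⟨ eq₂ ∣ X ⊕ B ∣ _ _ ⟩
      ∣ X ⊕ B ∣ ^ suc j * ∣ X ∣ ∎

  ×ˢ-suc⁺ : ∀ k {B x U} → x ⊆ B → U ⊆ k ×ˢ B → x ⊕ U ⊆ suc k ×ˢ B
  ×ˢ-suc⁺ k {B} {x} x⊆ U⊆ = ⊕-mono {x} {B} x⊆ U⊆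

  ⊆1×ˢ : ∀ {U B} → U ⊆ B → U ⊆ 1 ×ˢ B
  ⊆1×ˢ {U} {B} U⊆ {x} x∈ = subst (_∈ 1 ×ˢ B) (𝔾.identityʳ x) (⊕⁺ (U⊆ x∈) (x∈⁅x⁆ 0#))

  -- Distinct summands reduce to a multiple sumset of their union, whose sum with D is at most the
  -- sum of the separate sizes. `plünnecke₄` uses the same device.
  plünnecke₂ : ∀ D U V → 0 < ∣ D ∣ →
    ∣ D ∣ * ∣ U ⊕ V ∣ ≤ (∣ D ⊕ U ∣ + ∣ D ⊕ V ∣) ^ 2
  plünnecke₂ D U V 0<D = *-cancelʳ-≤ _ _ ∣ D ∣ {{>-nonZero 0<D}} (begin
    ∣ D ∣ * ∣ U ⊕ V ∣ * ∣ D ∣ ≡⟨ eq ∣ D ∣ ∣ U ⊕ V ∣ ⟩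
    ∣ D ∣ ^ 2 * ∣ U ⊕ V ∣
      ≤⟨ *-monoʳ-≤ (∣ D ∣ ^ 2) (p⊆q⇒∣p∣≤∣q∣ (×ˢ-suc⁺ 1 {B} {U} {V} (x∈p∪q⁺ ∘ inj₁) (⊆1×ˢ (x∈p∪q⁺ ∘ inj₂)))) ⟩
    ∣ D ∣ ^ 2 * ∣ 2 ×ˢ B ∣ ≤⟨ plünnecke 2 D B 0<D ⟩
    ∣ D ⊕ B ∣ ^ 2 * ∣ D ∣ ≤⟨ *-monoˡ-≤ ∣ D ∣ (^-monoˡ-≤ 2 (card-⊕-∪ D U V)) ⟩
    (∣ D ⊕ U ∣ + ∣ D ⊕ V ∣) ^ 2 * ∣ D ∣ ∎)
    where
    open ≤-Reasoning
    B = U ∪ V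
    eq : ∀ a b → a * b * a ≡ a * (a * 1) * b
    eq = solve-∀

  plünnecke₄ : ∀ Y U₁ U₂ U₃ U₄ → 0 < ∣ Y ∣ →
    ∣ Y ∣ ^ 3 * ∣ U₁ ⊕ (U₂ ⊕ (U₃ ⊕ U₄)) ∣ ≤
    (∣ Y ⊕ U₁ ∣ + (∣ Y ⊕ U₂ ∣ + (∣ Y ⊕ U₃ ∣ + ∣ Y ⊕ U₄ ∣))) ^ 4
  plünnecke₄ Y U₁ U₂ U₃ U₄ 0<Y = *-cancelʳ-≤ _ _ ∣ Y ∣ {{>-nonZero 0<Y}} (begin
    ∣ Y ∣ ^ 3 * ∣ Q ∣ * ∣ Y ∣ ≡⟨ eq (∣ Y ∣) (∣ Y ∣ ^ 3) (∣ Q ∣) ⟩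
    ∣ Y ∣ ^ 4 * ∣ Q ∣ ≤⟨ *-monoʳ-≤ (∣ Y ∣ ^ 4) (p⊆q⇒∣p∣≤∣q∣ Q⊆) ⟩
    ∣ Y ∣ ^ 4 * ∣ 4 ×ˢ B ∣ ≤⟨ plünnecke 4 Y B 0<Y ⟩
    ∣ Y ⊕ B ∣ ^ 4 * ∣ Y ∣ ≤⟨ *-monoˡ-≤ ∣ Y ∣ (^-monoˡ-≤ 4
       (≤-trans (card-⊕-∪ Y U₁ _) (+-monoʳ-≤ ∣ Y ⊕ U₁ ∣
         (≤-trans (card-⊕-∪ Y U₂ _) (+-monoʳ-≤ ∣ Y ⊕ U₂ ∣ (card-⊕-∪ Y U₃ U₄)))))) ⟩
    (∣ Y ⊕ U₁ ∣ + (∣ Y ⊕ U₂ ∣ + (∣ Y ⊕ U₃ ∣ + ∣ Y ⊕ U₄ ∣))) ^ 4 * ∣ Y ∣ ∎)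
    where
    open ≤-Reasoning
    B = U₁ ∪ (U₂ ∪ (U₃ ∪ U₄))
    Q = U₁ ⊕ (U₂ ⊕ (U₃ ⊕ U₄))
    right : ∀ {x : Fin p} {S T} → x ∈ T → x ∈ S ∪ T
    right = x∈p∪q⁺ ∘ inj₂
    Q⊆ : Q ⊆ 4 ×ˢ B
    Q⊆ = ×ˢ-suc⁺ 3 {B} {U₁} {U₂ ⊕ (U₃ ⊕ U₄)} (x∈p∪q⁺ ∘ inj₁)
        (×ˢ-suc⁺ 2 {B} {U₂} {U₃ ⊕ U₄} (right ∘ x∈p∪q⁺ ∘ inj₁)
        (×ˢ-suc⁺ 1 {B} {U₃} {U₄} (right ∘ right ∘ x∈p∪q⁺ ∘ inj₁)
        (⊆1×ˢ (right ∘ right ∘ right))))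
    eq : ∀ a b c → b * c * a ≡ a * b * c
    eq = solve-∀

  -- The union of B₁ and B₂ would give the square of |Y+B₁| + |Y+B₂|, too much when the sizes
  -- differ. With u = |Y+B₂| and v = |Y+B₁| the two terms of F(Z) = u|Z+B₁| + v|Z+B₂| balance at Z =
  -- Y, where F is 2uv, and a single minimiser X serves both. Petridis gives v|X+B₁+B₂| ≤
  -- F(X)|X+B₁|/|X|, and both F(X) and u|X+B₁| are at most 2uv|X|/|Y|; hence the 4.
  plünnecke-two-weights : ∀ Y B₁ B₂ → 0 < ∣ Y ∣ → 0 < ∣ Y ⊕ B₁ ∣ → 0 < ∣ Y ⊕ B₂ ∣ →
    ∃ λ X → X ⊆ Y × 0 < ∣ X ∣ ×
      ∣ Y ∣ ^ 2 * ∣ X ⊕ (B₁ ⊕ B₂) ∣ ≤ 4 * (∣ Y ⊕ B₁ ∣ * ∣ Y ⊕ B₂ ∣) * ∣ X ∣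
  plünnecke-two-weights Y B₁ B₂ 0<Y 0<v 0<u
    with X , X⊆Y , 0<X , ratio , min ←
           ratio-minimizer (λ X → ∣ Y ⊕ B₂ ∣ * ∣ X ⊕ B₁ ∣ + ∣ Y ⊕ B₁ ∣ * ∣ X ⊕ B₂ ∣) Y 0<Y =
    X , X⊆Y , 0<X , *-cancelʳ-≤ _ _ (u * v * x)
      {{m*n≢0 (u * v) x {{m*n≢0 u v {{>-nonZero 0<u}} {{>-nonZero 0<v}}}} {{>-nonZero 0<X}}}} (begin
        y ^ 2 * w * (u * v * ∣ X ∣) ≡⟨ eq₁ y w u v ∣ X ∣ ⟩
        y * y * (u * (v * w * ∣ X ∣))
          ≤⟨ *-monoʳ-≤ (y * y) (*-monoʳ-≤ u (≤-trans (*-monoˡ-≤ ∣ X ∣ vw≤) (petridis sF X min B₁))) ⟩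
        y * y * (u * (F X * ∣ X ⊕ B₁ ∣)) ≡⟨ eq₂ y u (F X) ∣ X ⊕ B₁ ∣ ⟩
        F X * y * (u * ∣ X ⊕ B₁ ∣ * y)
          ≤⟨ *-mono-≤ ratio (≤-trans (*-monoˡ-≤ y (m≤m+n (u * ∣ X ⊕ B₁ ∣) _)) ratio) ⟩
        F Y * ∣ X ∣ * (F Y * ∣ X ∣) ≡⟨ eq₃ u v ∣ X ∣ ⟩
        4 * (v * u) * ∣ X ∣ * (u * v * ∣ X ∣) ∎)
    where
    open ≤-Reasoning
    y = ∣ Y ∣
    x = ∣ X ∣
    u = ∣ Y ⊕ B₂ ∣
    v = ∣ Y ⊕ B₁ ∣
    w = ∣ X ⊕ (B₁ ⊕ B₂) ∣
    F : Subset p → ℕ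
    F Z = u * ∣ Z ⊕ B₁ ∣ + v * ∣ Z ⊕ B₂ ∣
    sF : Submodular F
    sF = combination-submodular u v (card-⊕-submodular B₁) (card-⊕-submodular B₂)
    vw≤ : v * w ≤ F (X ⊕ B₁)
    vw≤ = ≤-trans (≤-reflexive (cong (λ Z → v * ∣ Z ∣) (sym (⊕-assoc X B₁ B₂)))) (m≤n+m _ _)
    eq₁ : ∀ y w u v x → y * (y * 1) * w * (u * v * x) ≡ y * y * (u * (v * w * x))
    eq₁ = solve-∀
    eq₂ : ∀ y u f b → y * y * (u * (f * b)) ≡ f * y * (u * b * y)
    eq₂ = solve-∀
    eq₃ : ∀ u v x → (u * v + v * u) * x * ((u * v + v * u) * x) ≡ 4 * (v * u) * x * (u * v * x)
    eq₃ = solve-∀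

  negate : Subset p → Subset p
  negate Y = setOf λ z → (⊟ z) ∈? Y

  -- Ruzsa's injection as a double count. Each d = x - y has |Z| elements v = y + z of Y + Z with d
  -- + v = x + z in X + Z, and for fixed v the value d + v determines d.
  ruzsa-triangle : ∀ X Y Z → ∣ Z ∣ * ∣ X ⊕ negate Y ∣ ≤ ∣ X ⊕ Z ∣ * ∣ Y ⊕ Z ∣
  ruzsa-triangle X Y Z = begin
    ∣ Z ∣ * ∣ Δ ∣ ≡⟨ *-comm ∣ Z ∣ ∣ Δ ∣ ⟩
    ∣ Δ ∣ * ∣ Z ∣ ≡⟨ sym (sumOver-const Δ ∣ Z ∣) ⟩
    sumOver Δ (λ _ → ∣ Z ∣) ≤⟨ sumOver-mono-≤ Δ fibre ⟩
    sumOver Δ (λ d → sumOver (Y ⊕ Z) λ v → χ (X ⊕ Z) (d ⊞ v)) ≡⟨ sumOver-comm Δ (Y ⊕ Z) _ ⟩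
    sumOver (Y ⊕ Z) (λ v → sumOver Δ λ d → χ (X ⊕ Z) (d ⊞ v))
      ≤⟨ sumOver-mono-≤ (Y ⊕ Z) (λ {v} _ →
           sumOver-χ-injective Δ (X ⊕ Z) (_⊞ v) (∙-cancelʳ v _ _)) ⟩
    sumOver (Y ⊕ Z) (λ _ → ∣ X ⊕ Z ∣) ≡⟨ sumOver-const (Y ⊕ Z) ∣ X ⊕ Z ∣ ⟩
    ∣ Y ⊕ Z ∣ * ∣ X ⊕ Z ∣ ≡⟨ *-comm ∣ Y ⊕ Z ∣ _ ⟩
    ∣ X ⊕ Z ∣ * ∣ Y ⊕ Z ∣ ∎
    where
    open ≤-Reasoning
    Δ = X ⊕ negate Y
    fibre : ∀ {d} → d ∈ Δ → ∣ Z ∣ ≤ sumOver (Y ⊕ Z) (λ v → χ (X ⊕ Z) (d ⊞ v))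
    -- Here `y` lies in `negate Y`, so it is `⊟ y` that belongs to Y.
    fibre d∈ with x , y , x∈ , y∈ , refl ← ⊕⁻ X (negate Y) d∈ =
      ≤-trans (card-injection Z V ((⊟ y) ⊞_) inV λ _ _ → ∙-cancelˡ (⊟ y) _ _)
        (card-filter≤ (Y ⊕ Z) (X ⊕ Z) ((x ⊞ y) ⊞_))
      where
      V? = λ v → (v ∈? (Y ⊕ Z)) ×-dec (((x ⊞ y) ⊞ v) ∈? (X ⊕ Z))
      V = setOf V?
      inV : ∀ {z} → z ∈ Z → (⊟ y) ⊞ z ∈ V
      inV {z} z∈ = ∈-setOf⁺ V? (⊕⁺ (∈-setOf⁻ (λ z → (⊟ z) ∈? Y) y∈) z∈ ,
        subst (_∈ X ⊕ Z) (sym (trans (𝔾.assoc x y _) (cong (x ⊞_)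
          (trans (sym (𝔾.assoc y (⊟ y) z)) (trans (cong (_⊞ z) (𝔾.inverseʳ y)) (𝔾.identityˡ z))))))
          (⊕⁺ x∈ z∈))

-- Dilates and ratio sets

-- Multiplying the hypothesis n³ ≤ S L N m to the fourth power by n³ makes n³ N⁴ m³ appear.
optimise : ∀ n N m S L W → 0 < n → m ≤ n → n ^ 3 ≤ S * (L * (N * m)) → n ^ 3 * N ^ 4 * m ^ 3 ≤ W →
  n ^ 14 ≤ L ^ 4 * (S ^ 4 * W)
optimise n N m S L W 0<n m≤n n³≤ ≤W = *-cancelˡ-≤ n {{>-nonZero 0<n}} (begin
  n ^ 15 ≡⟨ ^-distribˡ-+-* n 3 12 ⟩
  n ^ 3 * n ^ 12 ≡⟨ cong (n ^ 3 *_) (sym (^-*-assoc n 3 4)) ⟩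
  n ^ 3 * (n ^ 3) ^ 4 ≤⟨ *-monoʳ-≤ (n ^ 3) (^-monoˡ-≤ 4 n³≤) ⟩
  n ^ 3 * (S * (L * (N * m))) ^ 4 ≡⟨ cong (n ^ 3 *_) expand ⟩
  n ^ 3 * (S ^ 4 * (L ^ 4 * (N ^ 4 * (m * m ^ 3))))
    ≡⟨ eq (n ^ 3) (S ^ 4) (L ^ 4) (N ^ 4) m (m ^ 3) ⟩
  m * (L ^ 4 * (S ^ 4 * (n ^ 3 * N ^ 4 * m ^ 3)))
    ≤⟨ *-mono-≤ m≤n (*-monoʳ-≤ (L ^ 4) (*-monoʳ-≤ (S ^ 4) ≤W)) ⟩
  n * (L ^ 4 * (S ^ 4 * W)) ∎)
  where
  open ≤-Reasoning
  expand : (S * (L * (N * m))) ^ 4 ≡ S ^ 4 * (L ^ 4 * (N ^ 4 * m ^ 4))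
  expand = trans (*-distrib-^ S (L * (N * m)) 4) (cong (S ^ 4 *_)
    (trans (*-distrib-^ L (N * m) 4) (cong (L ^ 4 *_) (*-distrib-^ N m 4))))
  eq : ∀ n³ s l N m m³ → n³ * (s * (l * (N * (m * m³)))) ≡ m * (l * (s * (n³ * N * m³)))
  eq = solve-∀

-- Division never occurs: cancellation comes from the absence of zero divisors. The last hypothesis
-- says that 1 generates the additive group; it excludes proper subfields, on which sums and
-- products do not grow.
module SumProduct {p : ℕ} (_⊞_ _⊠_ : Op₂ (Fin p)) (⊟_ : Op₁ (Fin p)) (0# 1# : Fin p)
  (isCommutativeRing : IsCommutativeRing _≡_ _⊞_ _⊠_ ⊟_ 0# 1#)
  (zeroDivisorFree : ∀ x y → x ⊠ y ≡ 0# → x ≡ 0# ⊎ y ≡ 0#)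
  (1#-generates : ∀ P → 0# ∈ P → (∀ {x} → x ∈ P → x ⊞ 1# ∈ P) → ∀ x → x ∈ P) where

  private
    𝔽 : CommutativeRing _ _
    𝔽 = record { isCommutativeRing = isCommutativeRing }
    module 𝔽 = CommutativeRing 𝔽
    open RingProperties 𝔽.ring

  open Additive _⊞_ 0# ⊟_ 𝔽.+-isAbelianGroup

  difference-zero⇒≡ : ∀ {x y} → x ⊞ (⊟ y) ≡ 0# → x ≡ y
  difference-zero⇒≡ {x} {y} e = +-cancelʳ (⊟ y) x y (trans e (sym (𝔽.-‿inverseʳ y)))

  ⊠-cancelˡ : ∀ {a x y} → a ≢ 0# → a ⊠ x ≡ a ⊠ y → x ≡ y
  ⊠-cancelˡ {a} {x} {y} a≢0 e with zeroDivisorFree a (x ⊞ (⊟ y)) (trans (𝔽.distribˡ a x (⊟ y))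
    (trans (cong₂ _⊞_ e (sym (-‿distribʳ-* a y))) (𝔽.-‿inverseʳ (a ⊠ y))))
  ... | inj₁ a≡0 = contradiction a≡0 a≢0
  ... | inj₂ d≡0 = difference-zero⇒≡ d≡0

  infixr 8 _⊙_
  _⊙_ : Fin p → Subset p → Subset p
  c ⊙ B = image₂ _⊠_ ⁅ c ⁆ B

  ⊙⁺ : ∀ c {B b} → b ∈ B → c ⊠ b ∈ c ⊙ B
  ⊙⁺ c {B} b∈ = ∈-image₂⁺ _⊠_ {⁅ c ⁆} {B} (x∈⁅x⁆ c) b∈

  ⊙⁻ : ∀ c B {z} → z ∈ c ⊙ B → ∃ λ b → b ∈ B × c ⊠ b ≡ z
  ⊙⁻ c B z∈ with _ , b , c∈ , b∈ , refl ← ∈-image₂⁻ _⊠_ {⁅ c ⁆} {B} z∈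
            with refl ← x∈⁅y⁆⇒x≡y c c∈ = b , b∈ , refl

  ⊙-mono : ∀ c {A B} → A ⊆ B → c ⊙ A ⊆ c ⊙ B
  ⊙-mono c {A} A⊆B z∈ with _ , b∈ , refl ← ⊙⁻ c A z∈ = ⊙⁺ c (A⊆B b∈)

  card-⊙≤ : ∀ c B → ∣ c ⊙ B ∣ ≤ ∣ B ∣
  card-⊙≤ c B = card-surjection (c ⊙ B) B (c ⊠_) (⊙⁻ c B)

  card≤⊙ : ∀ {c} B → c ≢ 0# → ∣ B ∣ ≤ ∣ c ⊙ B ∣
  card≤⊙ {c} B c≢0 = card-injection B (c ⊙ B) (c ⊠_) (⊙⁺ c) λ _ _ → ⊠-cancelˡ c≢0

  ⊙-distrib-⊕ : ∀ c A B → c ⊙ A ⊕ c ⊙ B ⊆ c ⊙ (A ⊕ B)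
  ⊙-distrib-⊕ c A B z∈ with _ , _ , a∈ , b∈ , refl ← ⊕⁻ (c ⊙ A) (c ⊙ B) z∈
                       with a , a∈A , refl ← ⊙⁻ c A a∈ with b , b∈B , refl ← ⊙⁻ c B b∈ =
    subst (_∈ c ⊙ (A ⊕ B)) (𝔽.distribˡ c a b) (⊙⁺ c (⊕⁺ a∈A b∈B))

  difference-⊙ : ∀ a b B → (a ⊞ (⊟ b)) ⊙ B ⊆ a ⊙ B ⊕ (⊟ b) ⊙ B
  difference-⊙ a b B z∈ with x , x∈ , refl ← ⊙⁻ (a ⊞ (⊟ b)) B z∈ =
    subst (_∈ a ⊙ B ⊕ (⊟ b) ⊙ B) (sym (𝔽.distribʳ x a (⊟ b))) (⊕⁺ (⊙⁺ a x∈) (⊙⁺ (⊟ b) x∈))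

  module _ (A : Subset p) {S : ℕ} (A+A≤S : ∣ A ⊕ A ∣ ≤ S) where

    -- D + aA lies in a(A + A). It is used for D = aA ∩ bA, which lies in both dilates.
    card-⊕-∩-⊙ : ∀ a {D} → D ⊆ a ⊙ A → ∣ D ⊕ a ⊙ A ∣ ≤ S
    card-⊕-∩-⊙ a {D} D⊆ = ≤-trans (p⊆q⇒∣p∣≤∣q∣ (⊙-distrib-⊕ a A A ∘ ⊕-mono {D} {a ⊙ A} D⊆ id))
      (≤-trans (card-⊙≤ a (A ⊕ A)) A+A≤S)

    card-sum-of-dilates : ∀ a b → 0 < ∣ a ⊙ A ∩ b ⊙ A ∣ →
      ∣ a ⊙ A ∩ b ⊙ A ∣ * ∣ b ⊙ A ⊕ a ⊙ A ∣ ≤ (S + S) ^ 2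
    card-sum-of-dilates a b 0<D = ≤-trans (plünnecke₂ (a ⊙ A ∩ b ⊙ A) (b ⊙ A) (a ⊙ A) 0<D)
      (^-monoˡ-≤ 2 (+-mono-≤ (card-⊕-∩-⊙ b (p∩q⊆q (a ⊙ A) (b ⊙ A)))
                             (card-⊕-∩-⊙ a (p∩q⊆p (a ⊙ A) (b ⊙ A)))))

    -- D - aA would lead to A - A, on which there is no bound; Ruzsa's inequality through D involves
    -- only D + aA and D + bA.
    card-difference-of-dilates : ∀ a b →
      ∣ a ⊙ A ∩ b ⊙ A ∣ * ∣ b ⊙ A ⊕ (⊟ a) ⊙ A ∣ ≤ (S + S) ^ 2
    card-difference-of-dilates a b = begin
      ∣ D ∣ * ∣ b ⊙ A ⊕ (⊟ a) ⊙ A ∣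
        ≤⟨ *-monoʳ-≤ ∣ D ∣ (p⊆q⇒∣p∣≤∣q∣ (⊕-mono {b ⊙ A} id neg⊆)) ⟩
      ∣ D ∣ * ∣ b ⊙ A ⊕ negate (a ⊙ A) ∣ ≤⟨ ruzsa-triangle (b ⊙ A) (a ⊙ A) D ⟩
      ∣ b ⊙ A ⊕ D ∣ * ∣ a ⊙ A ⊕ D ∣
        ≡⟨ cong₂ (λ X Y → ∣ X ∣ * ∣ Y ∣) (⊕-comm (b ⊙ A) D) (⊕-comm (a ⊙ A) D) ⟩
      ∣ D ⊕ b ⊙ A ∣ * ∣ D ⊕ a ⊙ A ∣
        ≤⟨ *-mono-≤ (card-⊕-∩-⊙ b (p∩q⊆q (a ⊙ A) (b ⊙ A)))
                    (card-⊕-∩-⊙ a (p∩q⊆p (a ⊙ A) (b ⊙ A))) ⟩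
      -- Weakened so that sums and differences obey one bound.
      S * S ≤⟨ *-mono-≤ (m≤m+n S S) (≤-trans (m≤m+n S S) (≤-reflexive (sym (*-identityʳ _)))) ⟩
      (S + S) ^ 2 ∎
      where
      open ≤-Reasoning
      D = a ⊙ A ∩ b ⊙ A
      neg⊆ : (⊟ a) ⊙ A ⊆ negate (a ⊙ A)
      neg⊆ z∈ with x , x∈ , refl ← ⊙⁻ (⊟ a) A z∈ = ∈-setOf⁺ (λ z → (⊟ z) ∈? (a ⊙ A))
        (subst (_∈ a ⊙ A) (sym (trans (-‿distribˡ-* (⊟ a) x) (cong (_⊠ x) (-‿involutive a)))) (⊙⁺ a x∈))

    -- bA is a common base: its sum with each of the four dilates has at most (2S)²/N elements, and
    -- b ≠ 0 makes it as large as A. Plünnecke over bA then applies, with N⁴ absorbed into the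
    -- fourth power.
    card-four-dilates : ∀ b N → b ≢ 0# → 0 < N → 0 < ∣ A ∣ → ∀ a₁ a₂ a₃ a₄ →
      N ≤ ∣ a₁ ⊙ A ∩ b ⊙ A ∣ → N ≤ ∣ a₂ ⊙ A ∩ b ⊙ A ∣ →
      N ≤ ∣ a₃ ⊙ A ∩ b ⊙ A ∣ → N ≤ ∣ a₄ ⊙ A ∩ b ⊙ A ∣ →
      ∣ A ∣ ^ 3 * N ^ 4 * ∣ a₁ ⊙ A ⊕ ((⊟ a₂) ⊙ A ⊕ (a₃ ⊙ A ⊕ (⊟ a₄) ⊙ A)) ∣ ≤
      (4 * (S + S) ^ 2) ^ 4
    card-four-dilates b N b≢0 0<N 0<A a₁ a₂ a₃ a₄ N≤₁ N≤₂ N≤₃ N≤₄ = begin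
      ∣ A ∣ ^ 3 * N ^ 4 * Q ≡⟨ swap (∣ A ∣ ^ 3) (N ^ 4) Q ⟩
      N ^ 4 * (∣ A ∣ ^ 3 * Q) ≤⟨ *-monoʳ-≤ (N ^ 4) (*-monoˡ-≤ Q (^-monoˡ-≤ 3 A≤Y)) ⟩
      N ^ 4 * (∣ Y ∣ ^ 3 * Q)
        ≤⟨ *-monoʳ-≤ (N ^ 4) (plünnecke₄ Y (a₁ ⊙ A) ((⊟ a₂) ⊙ A) (a₃ ⊙ A) ((⊟ a₄) ⊙ A)
             (≤-trans 0<A A≤Y)) ⟩
      N ^ 4 * (x₁ + (x₂ + (x₃ + x₄))) ^ 4 ≡⟨ sym (*-distrib-^ N (x₁ + (x₂ + (x₃ + x₄))) 4) ⟩
      (N * (x₁ + (x₂ + (x₃ + x₄)))) ^ 4 ≡⟨ cong (_^ 4) (distrib N x₁ x₂ x₃ x₄) ⟩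
      (N * x₁ + (N * x₂ + (N * x₃ + N * x₄))) ^ 4
        ≤⟨ ^-monoˡ-≤ 4 (+-mono-≤ (sum≤ a₁ N≤₁) (+-mono-≤ (diff≤ a₂ N≤₂)
             (+-mono-≤ (sum≤ a₃ N≤₃) (diff≤ a₄ N≤₄)))) ⟩
      (M + (M + (M + M))) ^ 4
        ≡⟨ cong (λ x → (M + (M + (M + x))) ^ 4) (sym (+-identityʳ M)) ⟩
      (4 * M) ^ 4 ∎
      where
      open ≤-Reasoning
      Y = b ⊙ A
      M = (S + S) ^ 2
      Q = ∣ a₁ ⊙ A ⊕ ((⊟ a₂) ⊙ A ⊕ (a₃ ⊙ A ⊕ (⊟ a₄) ⊙ A)) ∣
      x₁ = ∣ Y ⊕ a₁ ⊙ A ∣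
      x₂ = ∣ Y ⊕ (⊟ a₂) ⊙ A ∣
      x₃ = ∣ Y ⊕ a₃ ⊙ A ∣
      x₄ = ∣ Y ⊕ (⊟ a₄) ⊙ A ∣
      A≤Y : ∣ A ∣ ≤ ∣ Y ∣
      A≤Y = card≤⊙ A b≢0
      sum≤ : ∀ a → N ≤ ∣ a ⊙ A ∩ b ⊙ A ∣ → N * ∣ Y ⊕ a ⊙ A ∣ ≤ M
      sum≤ a N≤ = ≤-trans (*-monoˡ-≤ _ N≤) (card-sum-of-dilates a b (≤-trans 0<N N≤))
      diff≤ : ∀ a → N ≤ ∣ a ⊙ A ∩ b ⊙ A ∣ → N * ∣ Y ⊕ (⊟ a) ⊙ A ∣ ≤ M
      diff≤ a N≤ = ≤-trans (*-monoˡ-≤ _ N≤) (card-difference-of-dilates a b)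
      swap : ∀ x y z → x * y * z ≡ y * (x * z)
      swap = solve-∀
      distrib : ∀ n a b c d → n * (a + (b + (c + d))) ≡ n * a + (n * b + (n * c + n * d))
      distrib = solve-∀

  -- Ratio sets and the growth of B + rB

  InRatioSet : Subset p → Fin p → Set
  InRatioSet B ξ = ∃ λ x → ∃ λ y → ∃ λ z → ∃ λ w → x ∈ B × y ∈ B × z ∈ B × w ∈ B ×
    z ≢ w × ξ ⊠ (z ⊞ (⊟ w)) ≡ x ⊞ (⊟ y)

  inRatioSet? : ∀ B → Decidable (InRatioSet B)
  inRatioSet? B ξ = any? λ x → any? λ y → any? λ z → any? λ w →
    (x ∈? B) ×-dec ((y ∈? B) ×-dec ((z ∈? B) ×-dec ((w ∈? B) ×-dec
    (¬? (z ≟ᶠ w) ×-dec ((ξ ⊠ (z ⊞ (⊟ w))) ≟ᶠ (x ⊞ (⊟ y)))))))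

  cross-difference : ∀ {ξ x y z w} → (ξ ⊠ z) ⊞ x ≡ (ξ ⊠ w) ⊞ y → (ξ ⊠ (z ⊞ (⊟ w))) ⊞ x ≡ y
  cross-difference {ξ} {x} {y} {z} {w} e = begin
    (ξ ⊠ (z ⊞ (⊟ w))) ⊞ x ≡⟨ cong (_⊞ x) (trans (𝔽.distribˡ ξ z (⊟ w)) (𝔽.+-comm _ _)) ⟩
    ((ξ ⊠ (⊟ w)) ⊞ (ξ ⊠ z)) ⊞ x ≡⟨ 𝔽.+-assoc _ _ x ⟩
    (ξ ⊠ (⊟ w)) ⊞ ((ξ ⊠ z) ⊞ x) ≡⟨ cong₂ _⊞_ (sym (-‿distribʳ-* ξ w)) e ⟩
    (⊟ (ξ ⊠ w)) ⊞ ((ξ ⊠ w) ⊞ y) ≡⟨ sym (𝔽.+-assoc _ _ y) ⟩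
    ((⊟ (ξ ⊠ w)) ⊞ (ξ ⊠ w)) ⊞ y ≡⟨ cong (_⊞ y) (𝔽.-‿inverseˡ (ξ ⊠ w)) ⟩
    0# ⊞ y ≡⟨ 𝔽.+-identityˡ y ⟩
    y ∎
    where open ≡-Reasoning

  ∈-translate⁻ : ∀ c X {z} → z ∈ ⁅ c ⁆ ⊕ X → ∃ λ x → x ∈ X × c ⊞ x ≡ z
  ∈-translate⁻ c X z∈ with _ , x , c∈ , x∈ , refl ← ⊕⁻ ⁅ c ⁆ X z∈ with refl ← x∈⁅y⁆⇒x≡y c c∈ =
    x , x∈ , refl

  module _ (B X : Subset p) (ξ : Fin p) where

    fibre : Fin p → Subset p
    fibre y = ⁅ ξ ⊠ y ⁆ ⊕ X

    -- A point common to two slices of X + ξB solves ξ(y - w) = x′ - x with x, x′ ∈ X, so overlaps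
    -- of slices exhibit ξ as a ratio of differences.
    fibre∩⁻ : ∀ y w {z} → z ∈ fibre y ∩ fibre w →
      ∃ λ x → x ∈ X × (ξ ⊠ (y ⊞ (⊟ w))) ⊞ x ∈ X × (ξ ⊠ y) ⊞ x ≡ z
    fibre∩⁻ y w z∈ with z∈y , z∈w ← x∈p∩q⁻ (fibre y) (fibre w) z∈
                   with x , x∈ , refl ← ∈-translate⁻ (ξ ⊠ y) X z∈y
                   with x′ , x′∈ , e ← ∈-translate⁻ (ξ ⊠ w) X z∈w =
      x , x∈ , subst (_∈ X) (sym (cross-difference (sym e))) x′∈ , refl

    fibre-cauchy-schwarz : (∣ B ∣ * ∣ X ∣) * (∣ B ∣ * ∣ X ∣) ≤
      ∣ X ⊕ ξ ⊙ B ∣ * sumOver B (λ y → sumOver B λ w → ∣ fibre y ∩ fibre w ∣)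
    fibre-cauchy-schwarz = ≤-trans (≤-reflexive (cong₂ _*_ total total))
      (cauchy-schwarz-family B fibre (X ⊕ ξ ⊙ B) fibre⊆)
      where
      total : ∣ B ∣ * ∣ X ∣ ≡ sumOver B λ y → ∣ fibre y ∣
      total = sym (trans (sumOver-cong B λ y → card-translate (ξ ⊠ y) X) (sumOver-const B ∣ X ∣))
      fibre⊆ : ∀ {y} → y ∈ B → fibre y ⊆ X ⊕ ξ ⊙ B
      fibre⊆ {y} y∈ z∈ with x , x∈ , refl ← ∈-translate⁻ (ξ ⊠ y) X z∈ =
        subst (_∈ X ⊕ ξ ⊙ B) (𝔽.+-comm x (ξ ⊠ y)) (⊕⁺ x∈ (⊙⁺ ξ y∈))

  -- Distinct slices sy + X are disjoint, since an overlap would put s into the ratio set. The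
  -- overlap sum is thus at most its diagonal |B||X|, and Cauchy-Schwarz returns the full count.
  ∉ratioSet⇒card-⊕-⊙ : ∀ {B X s} → X ⊆ B → 0 < ∣ B ∣ → 0 < ∣ X ∣ → ¬ InRatioSet B s →
    ∣ B ∣ * ∣ X ∣ ≤ ∣ X ⊕ s ⊙ B ∣
  ∉ratioSet⇒card-⊕-⊙ {B} {X} {s} X⊆B 0<B 0<X s∉ =
    *-cancelʳ-≤ _ _ (∣ B ∣ * ∣ X ∣) {{m*n≢0 _ _ {{>-nonZero 0<B}} {{>-nonZero 0<X}}}}
      (≤-trans (fibre-cauchy-schwarz B X s) (*-monoʳ-≤ ∣ X ⊕ s ⊙ B ∣ (begin
        sumOver B (λ y → sumOver B λ w → ∣ G y ∩ G w ∣)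
          ≤⟨ sumOver-mono-≤ B (λ {y} y∈ → sumOver-diagonal B (λ w → ∣ G y ∩ G w ∣) y
               (≤-trans (∣p∩q∣≤∣p∣ (G y) (G y)) (≤-reflexive (card-translate (s ⊠ y) X)))
               (disjoint y∈)) ⟩
        sumOver B (λ _ → ∣ X ∣ + ∣ B ∣ * 0)
          ≡⟨ trans (sumOver-const B _) (cong (∣ B ∣ *_)
               (trans (cong (∣ X ∣ +_) (*-zeroʳ ∣ B ∣)) (+-identityʳ _))) ⟩
        ∣ B ∣ * ∣ X ∣ ∎)))
    where
    open ≤-Reasoning
    G = fibre B X s
    disjoint : ∀ {y} → y ∈ B → ∀ {w} → w ∈ B → w ≢ y → ∣ G y ∩ G w ∣ ≤ 0
    disjoint {y} y∈ {w} w∈ w≢y =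
      ≤-reflexive (card-Empty empty)
      where
      empty : Empty (G y ∩ G w)
      empty (z , z∈) with x , x∈ , dx∈ , _ ← fibre∩⁻ B X s y w z∈ =
        s∉ (_ , x , y , w , X⊆B dx∈ , X⊆B x∈ , y∈ , w∈ , w≢y ∘ sym ,
          sym (trans (𝔽.+-assoc _ x (⊟ x)) (trans (cong (_ ⊞_) (𝔽.-‿inverseʳ x)) (𝔽.+-identityʳ _))))

  -- Average the overlap sum E(ξ) over all ξ, with m = |B|. A diagonal pair contributes pm in total;
  -- for y ≠ w, each pair x, x′ ∈ B admits at most one ξ with ξ(y - w) + x = x′, so the contribution
  -- is at most m². Some ξ therefore has E(ξ) ≤ 2m².
  exists-large-dilate-sum : ∀ B → 0 < ∣ B ∣ → ∣ B ∣ * ∣ B ∣ ≤ p →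
    ∃ λ ξ → ∣ B ∣ * ∣ B ∣ ≤ 2 * ∣ B ⊕ ξ ⊙ B ∣
  exists-large-dilate-sum B 0<B m²≤p = ξ ,
    *-cancelʳ-≤ _ _ (m * m) {{m*n≢0 m m {{>-nonZero 0<B}} {{>-nonZero 0<B}}}} (begin
      m * m * (m * m) ≤⟨ fibre-cauchy-schwarz B B ξ ⟩
      ∣ B ⊕ ξ ⊙ B ∣ * E ξ ≤⟨ *-monoʳ-≤ ∣ B ⊕ ξ ⊙ B ∣ E≤ ⟩
      ∣ B ⊕ ξ ⊙ B ∣ * (2 * (m * m)) ≡⟨ eq₁ ∣ B ⊕ ξ ⊙ B ∣ (m * m) ⟩
      2 * ∣ B ⊕ ξ ⊙ B ∣ * (m * m) ∎)
    where
    open ≤-Reasoning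
    m = ∣ B ∣
    G = fibre B B
    E : Fin p → ℕ
    E ξ = sumOver B λ y → sumOver B λ w → ∣ G ξ y ∩ G ξ w ∣
    eq₁ : ∀ u a → u * (2 * a) ≡ 2 * u * a
    eq₁ = solve-∀
    eq₂ : ∀ m p → m * (p * m + m * p) ≡ p * (2 * (m * m))
    eq₂ = solve-∀
    diagonal : ∀ y → sumOver ⊤ (λ ξ → ∣ G ξ y ∩ G ξ y ∣) ≤ p * m
    diagonal y = begin
      sumOver ⊤ (λ ξ → ∣ G ξ y ∩ G ξ y ∣)
        ≤⟨ sumOver-mono-≤ ⊤ (λ {ξ} _ → ≤-trans (∣p∩q∣≤∣p∣ (G ξ y) (G ξ y))
             (≤-reflexive (card-translate (ξ ⊠ y) B))) ⟩
      sumOver {p} ⊤ (λ _ → m) ≡⟨ trans (sumOver-const {p} ⊤ m) (cong (_* m) (∣⊤∣≡n p)) ⟩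
      p * m ∎
    off-diagonal : ∀ y w → w ≢ y → sumOver ⊤ (λ ξ → ∣ G ξ y ∩ G ξ w ∣) ≤ m * m
    off-diagonal y w w≢y = begin
      sumOver ⊤ (λ ξ → ∣ G ξ y ∩ G ξ w ∣)
        ≤⟨ sumOver-mono-≤ ⊤ (λ {ξ} _ → ≤-trans
             (card-surjection (G ξ y ∩ G ξ w) (setOf (V? ξ)) ((ξ ⊠ y) ⊞_) (pre ξ))
             (card-filter≤ B B ((ξ ⊠ d) ⊞_))) ⟩
      sumOver ⊤ (λ ξ → sumOver B λ x → χ B ((ξ ⊠ d) ⊞ x)) ≡⟨ sumOver-comm ⊤ B (λ ξ x → χ B ((ξ ⊠ d) ⊞ x)) ⟩
      sumOver B (λ x → sumOver ⊤ λ ξ → χ B ((ξ ⊠ d) ⊞ x))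
        ≤⟨ sumOver-mono-≤ B (λ {x} _ → sumOver-χ-injective ⊤ B (λ ξ → (ξ ⊠ d) ⊞ x) (inj x)) ⟩
      sumOver B (λ _ → m) ≡⟨ sumOver-const B m ⟩
      m * m ∎
      where
      d = y ⊞ (⊟ w)
      d≢0 : d ≢ 0#
      d≢0 = w≢y ∘ sym ∘ difference-zero⇒≡
      V? : ∀ ξ → Decidable λ x → x ∈ B × (ξ ⊠ d) ⊞ x ∈ B
      V? ξ x = (x ∈? B) ×-dec (((ξ ⊠ d) ⊞ x) ∈? B)
      pre : ∀ ξ {z} → z ∈ G ξ y ∩ G ξ w → ∃ λ x → x ∈ setOf (V? ξ) × (ξ ⊠ y) ⊞ x ≡ z
      pre ξ z∈ with x , x∈ , dx∈ , e ← fibre∩⁻ B B ξ y w z∈ = x , ∈-setOf⁺ (V? ξ) (x∈ , dx∈) , e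
      inj : ∀ x {ξ η} → (ξ ⊠ d) ⊞ x ≡ (η ⊠ d) ⊞ x → ξ ≡ η
      inj x {ξ} {η} e = ⊠-cancelˡ d≢0
        (trans (𝔽.*-comm d ξ) (trans (+-cancelʳ x _ _ e) (𝔽.*-comm η d)))
    ΣE≤ : sumOver ⊤ E ≤ p * (2 * (m * m))
    ΣE≤ = begin
      sumOver ⊤ E ≡⟨ trans (sumOver-comm ⊤ B λ ξ y → sumOver B λ w → ∣ G ξ y ∩ G ξ w ∣)
           (sumOver-cong B λ y → sumOver-comm ⊤ B λ ξ w → ∣ G ξ y ∩ G ξ w ∣) ⟩
      sumOver B (λ y → sumOver B λ w → sumOver ⊤ λ ξ → ∣ G ξ y ∩ G ξ w ∣)
        ≤⟨ sumOver-mono-≤ B (λ {y} _ → sumOver-diagonal B _ y (diagonal y)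
             (λ {w} _ → off-diagonal y w)) ⟩
      sumOver B (λ _ → p * m + m * (m * m)) ≡⟨ sumOver-const B _ ⟩
      -- The size condition m² ≤ p keeps the off-diagonal mass below the diagonal one.
      m * (p * m + m * (m * m)) ≤⟨ *-monoʳ-≤ m (+-monoʳ-≤ (p * m) (*-monoʳ-≤ m m²≤p)) ⟩
      m * (p * m + m * p) ≡⟨ eq₂ m p ⟩
      p * (2 * (m * m)) ∎
    0<p : 0 < p
    0<p = ≤-trans 0<B (∣p∣≤n B)
    average = averaging-min ⊤ E (≤-trans 0<p (≤-reflexive (sym (∣⊤∣≡n p))))
    ξ = proj₁ average
    E≤ : E ξ ≤ 2 * (m * m)
    E≤ = *-cancelˡ-≤ p {{>-nonZero 0<p}} (≤-trans (≤-reflexive (cong (_* E ξ) (sym (∣⊤∣≡n p))))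
      (≤-trans (proj₂ (proj₂ average)) ΣE≤))

  -- Multiplication by z - w is injective and clears the denominator of ξ.
  ratio-dilate-sum : ∀ B {ξ x y z w} → z ≢ w → ξ ⊠ (z ⊞ (⊟ w)) ≡ x ⊞ (⊟ y) →
    ∣ B ⊕ ξ ⊙ B ∣ ≤ ∣ (z ⊞ (⊟ w)) ⊙ B ⊕ (x ⊞ (⊟ y)) ⊙ B ∣
  ratio-dilate-sum B {ξ} {x} {y} {z} {w} z≢w e =
    card-injection _ _ (δ ⊠_) into λ _ _ → ⊠-cancelˡ (z≢w ∘ difference-zero⇒≡)
    where
    δ = z ⊞ (⊟ w)
    ε = x ⊞ (⊟ y)
    into : ∀ {t} → t ∈ B ⊕ ξ ⊙ B → δ ⊠ t ∈ δ ⊙ B ⊕ ε ⊙ B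
    into t∈ with a , _ , a∈ , ξb∈ , refl ← ⊕⁻ B (ξ ⊙ B) t∈ with b , b∈ , refl ← ⊙⁻ ξ B ξb∈ =
      subst (_∈ δ ⊙ B ⊕ ε ⊙ B) (sym (trans (𝔽.distribˡ δ a _) (cong ((δ ⊠ a) ⊞_)
        (trans (sym (𝔽.*-assoc δ ξ b)) (cong (_⊠ b) (trans (𝔽.*-comm δ ξ) e))))))
        (⊕⁺ (⊙⁺ δ a∈) (⊙⁺ ε b∈))

  two-elements : ∀ (B : Subset p) → 2 ≤ ∣ B ∣ → ∃ λ x → ∃ λ y → x ∈ B × y ∈ B × x ≢ y
  two-elements B 2≤B with any? (λ x → any? λ y → (x ∈? B) ×-dec ((y ∈? B) ×-dec ¬? (x ≟ᶠ y)))
  ... | yes r = r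
  ... | no ¬r with nonempty? B
  ...   | no empty = contradiction (subst (2 ≤_) (card-Empty empty) 2≤B) λ ()
  ...   | yes (x , x∈) = contradiction (≤-trans 2≤B (≤-trans
      (p⊆q⇒∣p∣≤∣q∣ λ {y} y∈ → subst (_∈ ⁅ x ⁆)
        (decidable-stable (x ≟ᶠ y) λ x≢y → ¬r (x , y , x∈ , y∈ , x≢y)) (x∈⁅x⁆ x))
      (≤-reflexive (∣⁅x⁆∣≡1 x)))) λ { (s≤s ()) }

  ratioSet-full : ∀ B → 2 ≤ ∣ B ∣ → ¬ (∃ λ r → InRatioSet B r × ¬ InRatioSet B (r ⊞ 1#)) →
    ∀ ξ → InRatioSet B ξ
  ratioSet-full B 2≤B ¬escape ξ with x , y , x∈ , y∈ , x≢y ← two-elements B 2≤B =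
    ∈-setOf⁻ (inRatioSet? B) (1#-generates (setOf (inRatioSet? B))
      -- The ratio 0 is (x - x)/(x - y), which takes two distinct elements of B.
      (∈-setOf⁺ (inRatioSet? B) (x , x , x , y , x∈ , x∈ , x∈ , y∈ , x≢y ,
        trans (𝔽.zeroˡ _) (sym (𝔽.-‿inverseʳ x))))
      (λ {r} r∈ → ∈-setOf⁺ (inRatioSet? B) (decidable-stable (inRatioSet? B (r ⊞ 1#))
        λ s∉ → ¬escape (r , ∈-setOf⁻ (inRatioSet? B) r∈ , s∉))) ξ)

  successor-dilate-⊆ : ∀ r B → (r ⊞ 1#) ⊙ B ⊆ B ⊕ r ⊙ B
  successor-dilate-⊆ r B t∈ with b , b∈ , refl ← ⊙⁻ (r ⊞ 1#) B t∈ =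
    subst (_∈ B ⊕ r ⊙ B) (sym (trans (𝔽.distribʳ b r 1#)
      (trans (𝔽.+-comm _ _) (cong (_⊞ (r ⊠ b)) (𝔽.*-identityˡ b))))) (⊕⁺ b∈ (⊙⁺ r b∈))

  -- X + B + rB contains X + (r+1)B, which has at least |X||B| elements because r + 1 is not a
  -- ratio. The two-weight inequality bounds X + B + rB from above, linearly in |B + rB|, and |X|
  -- cancels.
  expansion-at-ratio : ∀ B r → 0 < ∣ B ∣ → ¬ InRatioSet B (r ⊞ 1#) →
    ∣ B ∣ ^ 3 ≤ 4 * (∣ B ⊕ B ∣ * ∣ B ⊕ r ⊙ B ∣)
  expansion-at-ratio B r 0<B s∉ = from-minimal (plünnecke-two-weights B B (r ⊙ B) 0<B
    (≤-trans 0<B (card≤⊕ B B 0<B)) 0<B+rB)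
    where
    open ≤-Reasoning
    eq : ∀ m x → m * (m * (m * 1)) * x ≡ m * (m * 1) * (m * x)
    eq = solve-∀
    0<B+rB : 0 < ∣ B ⊕ r ⊙ B ∣
    0<B+rB with nonempty? B
    ... | yes (b , b∈) = 0<card (⊕⁺ b∈ (⊙⁺ r b∈))
    ... | no empty = contradiction (subst (0 <_) (card-Empty empty) 0<B) n≮0
    from-minimal : (∃ λ X → X ⊆ B × 0 < ∣ X ∣ ×
      ∣ B ∣ ^ 2 * ∣ X ⊕ (B ⊕ r ⊙ B) ∣ ≤ 4 * (∣ B ⊕ B ∣ * ∣ B ⊕ r ⊙ B ∣) * ∣ X ∣) →
      ∣ B ∣ ^ 3 ≤ 4 * (∣ B ⊕ B ∣ * ∣ B ⊕ r ⊙ B ∣)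
    from-minimal (X , X⊆B , 0<X , le) = *-cancelʳ-≤ _ _ ∣ X ∣ {{>-nonZero 0<X}} (begin
      ∣ B ∣ ^ 3 * ∣ X ∣ ≡⟨ eq (∣ B ∣) (∣ X ∣) ⟩
      ∣ B ∣ ^ 2 * (∣ B ∣ * ∣ X ∣)
        ≤⟨ *-monoʳ-≤ (∣ B ∣ ^ 2) (≤-trans (∉ratioSet⇒card-⊕-⊙ X⊆B 0<B 0<X s∉)
             (p⊆q⇒∣p∣≤∣q∣ (⊕-mono {X} {X} id (successor-dilate-⊆ r B)))) ⟩
      ∣ B ∣ ^ 2 * ∣ X ⊕ (B ⊕ r ⊙ B) ∣ ≤⟨ le ⟩
      4 * (∣ B ⊕ B ∣ * ∣ B ⊕ r ⊙ B ∣) * ∣ X ∣ ∎)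

  ratio-with-expansion : ∀ B → 2 ≤ ∣ B ∣ → ∣ B ∣ * ∣ B ∣ ≤ p →
    ∃ λ r → InRatioSet B r × ∣ B ∣ ^ 3 ≤ 4 * (∣ B ⊕ B ∣ * ∣ B ⊕ r ⊙ B ∣)
  ratio-with-expansion B 2≤B m²≤p = cases (any? escape?)
    where
    open ≤-Reasoning
    escape? : Decidable λ r → InRatioSet B r × ¬ InRatioSet B (r ⊞ 1#)
    escape? r = inRatioSet? B r ×-dec ¬? (inRatioSet? B (r ⊞ 1#))
    0<B : 0 < ∣ B ∣
    0<B = ≤-trans (s≤s z≤n) 2≤B
    -- When every element is a ratio, |B|² ≤ 2|B+rB| is brought to the form of the other case
    -- through |B| ≤ |B+B|.
    weaken : ∀ {m s q} → m ≤ s → m * m ≤ 2 * q → m ^ 3 ≤ 4 * (s * q)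
    weaken {m} {s} {q} m≤s m²≤2q = begin
      m * (m * (m * 1)) ≡⟨ cong (λ t → m * (m * t)) (*-identityʳ m) ⟩
      m * (m * m) ≤⟨ *-mono-≤ m≤s m²≤2q ⟩
      s * (2 * q) ≤⟨ m≤m+n (s * (2 * q)) (s * (2 * q)) ⟩
      s * (2 * q) + s * (2 * q) ≡⟨ eq s q ⟩
      4 * (s * q) ∎
      where
      eq : ∀ s q → s * (2 * q) + s * (2 * q) ≡ 4 * (s * q)
      eq = solve-∀
    cases : Dec (∃ λ r → InRatioSet B r × ¬ InRatioSet B (r ⊞ 1#)) →
      ∃ λ r → InRatioSet B r × ∣ B ∣ ^ 3 ≤ 4 * (∣ B ⊕ B ∣ * ∣ B ⊕ r ⊙ B ∣)
    cases (yes (r , r∈ , s∉)) = r , r∈ , expansion-at-ratio B r 0<B s∉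
    cases (no ¬escape) = use (exists-large-dilate-sum B 0<B m²≤p)
      where
      use : (∃ λ ξ → ∣ B ∣ * ∣ B ∣ ≤ 2 * ∣ B ⊕ ξ ⊙ B ∣) →
        ∃ λ r → InRatioSet B r × ∣ B ∣ ^ 3 ≤ 4 * (∣ B ⊕ B ∣ * ∣ B ⊕ r ⊙ B ∣)
      use (ξ , m²≤) = ξ , ratioSet-full B 2≤B ¬escape ξ , weaken (card≤⊕ B B 0<B) m²≤

  expansion : ∀ B → 2 ≤ ∣ B ∣ → ∣ B ∣ * ∣ B ∣ ≤ p →
    ∃ λ x → ∃ λ y → ∃ λ z → ∃ λ w → x ∈ B × y ∈ B × z ∈ B × w ∈ B ×
      ∣ B ∣ ^ 3 ≤ 4 * (∣ B ⊕ B ∣ * ∣ (z ⊞ (⊟ w)) ⊙ B ⊕ (x ⊞ (⊟ y)) ⊙ B ∣)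
  expansion B 2≤B m²≤p = conclude (ratio-with-expansion B 2≤B m²≤p)
    where
    conclude : (∃ λ r → InRatioSet B r × ∣ B ∣ ^ 3 ≤ 4 * (∣ B ⊕ B ∣ * ∣ B ⊕ r ⊙ B ∣)) →
      ∃ λ x → ∃ λ y → ∃ λ z → ∃ λ w → x ∈ B × y ∈ B × z ∈ B × w ∈ B ×
      ∣ B ∣ ^ 3 ≤ 4 * (∣ B ⊕ B ∣ * ∣ (z ⊞ (⊟ w)) ⊙ B ⊕ (x ⊞ (⊟ y)) ⊙ B ∣)
    conclude (r , (x , y , z , w , x∈ , y∈ , z∈ , w∈ , z≢w , e) , le) =
      x , y , z , w , x∈ , y∈ , z∈ , w∈ ,
      ≤-trans le (*-monoʳ-≤ 4 (*-monoʳ-≤ ∣ B ⊕ B ∣ (ratio-dilate-sum B z≢w e)))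

  positive-⊙ : ∀ {A x} c → x ∈ A → 0 < ∣ c ⊙ A ∣
  positive-⊙ c x∈ = 0<card (⊙⁺ c x∈)

  positive-⊕ : ∀ A B → 0 < ∣ A ∣ → 0 < ∣ B ∣ → 0 < ∣ A ⊕ B ∣
  positive-⊕ A B 0<A 0<B = ≤-trans 0<B (card≤⊕ A B 0<A)

  fourfold : Subset p → (x y z w : Fin p) → Subset p
  fourfold A x y z w = z ⊙ A ⊕ ((⊟ w) ⊙ A ⊕ (x ⊙ A ⊕ (⊟ y) ⊙ A))

  differences-⊆-fourfold : ∀ {A B} x y z w → B ⊆ A →
    (z ⊞ (⊟ w)) ⊙ B ⊕ (x ⊞ (⊟ y)) ⊙ B ⊆ fourfold A x y z w
  differences-⊆-fourfold {A} {B} x y z w B⊆A {t} t∈ =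
    subst (t ∈_) (⊕-assoc (z ⊙ A) ((⊟ w) ⊙ A) (x ⊙ A ⊕ (⊟ y) ⊙ A))
      (⊕-mono {(z ⊞ (⊟ w)) ⊙ B} {z ⊙ A ⊕ (⊟ w) ⊙ A} {(x ⊞ (⊟ y)) ⊙ B} {x ⊙ A ⊕ (⊟ y) ⊙ A}
        (difference-⊙ z w A ∘ ⊙-mono (z ⊞ (⊟ w)) B⊆A)
        (difference-⊙ x y A ∘ ⊙-mono (x ⊞ (⊟ y)) B⊆A) t∈)

  expansion-in : ∀ {A B b} → B ⊆ A → b ∈ B → ∣ B ∣ * ∣ B ∣ ≤ p →
    ∃ λ x → ∃ λ y → ∃ λ z → ∃ λ w → x ∈ B × y ∈ B × z ∈ B × w ∈ B ×
      ∣ B ∣ ^ 3 ≤ 4 * (∣ A ⊕ A ∣ * ∣ fourfold A x y z w ∣)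
  expansion-in {A} {B} {b} B⊆A b∈ m²≤p = cases (2 ≤? ∣ B ∣)
    where
    Goal : Set
    Goal = ∃ λ x → ∃ λ y → ∃ λ z → ∃ λ w → x ∈ B × y ∈ B × z ∈ B × w ∈ B ×
      ∣ B ∣ ^ 3 ≤ 4 * (∣ A ⊕ A ∣ * ∣ fourfold A x y z w ∣)
    b∈A : b ∈ A
    b∈A = B⊆A b∈
    positive : ∀ x y z w → 0 < ∣ fourfold A x y z w ∣
    positive x y z w = positive-⊕ (z ⊙ A) _ (positive-⊙ z b∈A)
      (positive-⊕ ((⊟ w) ⊙ A) _ (positive-⊙ (⊟ w) b∈A)
        (positive-⊕ (x ⊙ A) _ (positive-⊙ x b∈A) (positive-⊙ (⊟ y) b∈A)))
    use : (∃ λ x → ∃ λ y → ∃ λ z → ∃ λ w → x ∈ B × y ∈ B × z ∈ B × w ∈ B ×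
      ∣ B ∣ ^ 3 ≤ 4 * (∣ B ⊕ B ∣ * ∣ (z ⊞ (⊟ w)) ⊙ B ⊕ (x ⊞ (⊟ y)) ⊙ B ∣)) → Goal
    use (x , y , z , w , x∈ , y∈ , z∈ , w∈ , le) = x , y , z , w , x∈ , y∈ , z∈ , w∈ ,
      ≤-trans le (*-monoʳ-≤ 4 (*-mono-≤ (p⊆q⇒∣p∣≤∣q∣ (⊕-mono {B} {A} {B} {A} B⊆A B⊆A))
        (p⊆q⇒∣p∣≤∣q∣ (differences-⊆-fourfold x y z w B⊆A))))
    cases : Dec (2 ≤ ∣ B ∣) → Goal
    cases (yes 2≤B) = use (expansion B 2≤B m²≤p)
    -- A single element has no ratios, but then |B|³ ≤ 1 and the sets on the right are nonempty.
    cases (no 2≰B) = b , b , b , b , b∈ , b∈ , b∈ , b∈ ,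
      ≤-trans (^-monoˡ-≤ 3 (≤-pred (≰⇒> 2≰B)))
        (*-mono-≤ {1} {4} (s≤s z≤n)
          (*-mono-≤ (positive-⊕ A A (0<card b∈A) (0<card b∈A)) (positive b b b b)))

  -- Multiplicative energy and the combined estimate

  -- The dilates aA have n elements each, as 0 ∉ A, and all lie in AA, so Cauchy-Schwarz bounds the
  -- energy below by n⁴/S. Fixing the b with the largest inner sum costs a factor n and singles out
  -- one reference dilate.
  multiplicative-energy : ∀ A {S} → 0 < ∣ A ∣ → (∀ {a} → a ∈ A → a ≢ 0#) →
    ∣ image₂ _⊠_ A A ∣ ≤ S →
    ∃ λ b → b ∈ A × ∣ A ∣ ^ 3 ≤ S * sumOver A (λ a → ∣ a ⊙ A ∩ b ⊙ A ∣)
  multiplicative-energy A {S} 0<A nonzero AA≤S =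
    use (averaging-max A (λ b → sumOver A λ a → ∣ b ⊙ A ∩ a ⊙ A ∣) 0<A)
    where
    open ≤-Reasoning
    n = ∣ A ∣
    E : ℕ
    E = sumOver A λ b → sumOver A λ a → ∣ b ⊙ A ∩ a ⊙ A ∣
    energy : (n * n) * (n * n) ≤ S * E
    energy = begin
      (n * n) * (n * n) ≡⟨ cong₂ _*_ (sym (sumOver-const A n)) (sym (sumOver-const A n)) ⟩
      sumOver A (λ _ → n) * sumOver A (λ _ → n) ≤⟨ *-mono-≤ dilates dilates ⟩
      sumOver A (λ a → ∣ a ⊙ A ∣) * sumOver A (λ a → ∣ a ⊙ A ∣)
        ≤⟨ cauchy-schwarz-family A (_⊙ A) (image₂ _⊠_ A A) sub ⟩
      ∣ image₂ _⊠_ A A ∣ * E ≤⟨ *-monoˡ-≤ E AA≤S ⟩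
      S * E ∎
      where
      dilates : sumOver A (λ _ → n) ≤ sumOver A (λ a → ∣ a ⊙ A ∣)
      dilates = sumOver-mono-≤ A λ a∈ → card≤⊙ A (nonzero a∈)
      sub : ∀ {a} → a ∈ A → a ⊙ A ⊆ image₂ _⊠_ A A
      sub {a} a∈ z∈ with b , b∈ , refl ← ⊙⁻ a A z∈ = ∈-image₂⁺ _⊠_ {A} {A} a∈ b∈
    eq₁ : ∀ n → n * (n * (n * 1)) * n ≡ (n * n) * (n * n)
    eq₁ = solve-∀
    eq₂ : ∀ s n e → s * (n * e) ≡ s * e * n
    eq₂ = solve-∀
    use : (∃ λ b → b ∈ A × E ≤ n * sumOver A λ a → ∣ b ⊙ A ∩ a ⊙ A ∣) →
      ∃ λ b → b ∈ A × n ^ 3 ≤ S * sumOver A (λ a → ∣ a ⊙ A ∩ b ⊙ A ∣)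
    use (b , b∈ , E≤) = b , b∈ , *-cancelʳ-≤ _ _ n {{>-nonZero 0<A}} (begin
      n ^ 3 * n ≡⟨ eq₁ n ⟩
      (n * n) * (n * n) ≤⟨ energy ⟩
      S * E ≤⟨ *-monoʳ-≤ S E≤ ⟩
      S * (n * sumOver A (λ a → ∣ b ⊙ A ∩ a ⊙ A ∣)) ≡⟨ eq₂ S n _ ⟩
      S * sumOver A (λ a → ∣ b ⊙ A ∩ a ⊙ A ∣) * n
        ≡⟨ cong (λ s → S * s * n) (sumOver-cong A λ a → cong ∣_∣ (∩-comm (b ⊙ A) (a ⊙ A))) ⟩
      S * sumOver A (λ a → ∣ a ⊙ A ∩ b ⊙ A ∣) * n ∎)

  -- The upper and lower estimates concern the same sum of four dilates, which is eliminated. Its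
  -- multipliers are supplied by the lower estimate and lie in B, so popularity applies to each.
  popular-dilates : ∀ A {S b N} → 0 < ∣ A ∣ → 0 < N → b ≢ 0# → ∣ A ∣ * ∣ A ∣ ≤ p → ∣ A ⊕ A ∣ ≤ S →
    let B = superlevel A (λ a → ∣ a ⊙ A ∩ b ⊙ A ∣) N in
    ∣ A ∣ ^ 3 * N ^ 4 * ∣ B ∣ ^ 3 ≤ 4 * S * (4 * (S + S) ^ 2) ^ 4
  popular-dilates A {S} {b} {N} 0<A 0<N b≢0 n²≤p A+A≤S = cases (nonempty? B)
    where
    open ≤-Reasoning
    popular? : Decidable λ a → a ∈ A × N ≤ ∣ a ⊙ A ∩ b ⊙ A ∣
    popular? a = (a ∈? A) ×-dec (N ≤? ∣ a ⊙ A ∩ b ⊙ A ∣)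
    B = superlevel A (λ a → ∣ a ⊙ A ∩ b ⊙ A ∣) N
    B⊆A : B ⊆ A
    B⊆A = proj₁ ∘ ∈-setOf⁻ popular?
    popular : ∀ {a} → a ∈ B → N ≤ ∣ a ⊙ A ∩ b ⊙ A ∣
    popular = proj₂ ∘ ∈-setOf⁻ popular?
    combine : ∀ {m s k q v} → m ≤ 4 * (s * q) → s ≤ S → k * q ≤ v → k * m ≤ 4 * S * v
    combine {m} {s} {k} {q} {v} m≤ s≤S kq≤v = begin
      k * m ≤⟨ *-monoʳ-≤ k m≤ ⟩
      k * (4 * (s * q)) ≡⟨ eq k s q ⟩
      4 * s * (k * q) ≤⟨ *-mono-≤ (*-monoʳ-≤ 4 s≤S) kq≤v ⟩
      4 * S * v ∎
      where
      eq : ∀ k s q → k * (4 * (s * q)) ≡ 4 * s * (k * q)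
      eq = solve-∀
    cases : Dec (Nonempty B) →
      ∣ A ∣ ^ 3 * N ^ 4 * ∣ B ∣ ^ 3 ≤ 4 * S * (4 * (S + S) ^ 2) ^ 4
    cases (no empty) = subst (λ m → ∣ A ∣ ^ 3 * N ^ 4 * m ^ 3 ≤ 4 * S * (4 * (S + S) ^ 2) ^ 4)
      (sym (card-Empty empty))
      (≤-trans (≤-reflexive (*-zeroʳ (∣ A ∣ ^ 3 * N ^ 4))) z≤n)
    cases (yes (a , a∈)) = use (expansion-in B⊆A a∈
      (≤-trans (*-mono-≤ (p⊆q⇒∣p∣≤∣q∣ B⊆A) (p⊆q⇒∣p∣≤∣q∣ B⊆A)) n²≤p))
      where
      use : (∃ λ x → ∃ λ y → ∃ λ z → ∃ λ w → x ∈ B × y ∈ B × z ∈ B × w ∈ B ×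
        ∣ B ∣ ^ 3 ≤ 4 * (∣ A ⊕ A ∣ * ∣ fourfold A x y z w ∣)) →
        ∣ A ∣ ^ 3 * N ^ 4 * ∣ B ∣ ^ 3 ≤ 4 * S * (4 * (S + S) ^ 2) ^ 4
      use (x , y , z , w , x∈ , y∈ , z∈ , w∈ , le) = combine {k = ∣ A ∣ ^ 3 * N ^ 4} le A+A≤S
        (card-four-dilates A A+A≤S b N b≢0 0<N 0<A z w x y
          (popular z∈) (popular w∈) (popular x∈) (popular y∈))

  sum-product : ∀ A L {S} → 0 < ∣ A ∣ → (∀ {a} → a ∈ A → a ≢ 0#) → ∣ A ∣ * ∣ A ∣ ≤ p →
    ∣ A ∣ < 2 ^ L → ∣ A ⊕ A ∣ ≤ S → ∣ image₂ _⊠_ A A ∣ ≤ S →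
    ∣ A ∣ ^ 14 ≤ L ^ 4 * (S ^ 4 * (4 * S * (4 * (S + S) ^ 2) ^ 4))
  sum-product A L {S} 0<A nonzero n²≤p n<2^L A+A≤S AA≤S =
    use (multiplicative-energy A 0<A nonzero AA≤S)
    where
    use : (∃ λ b → b ∈ A × ∣ A ∣ ^ 3 ≤ S * sumOver A (λ a → ∣ a ⊙ A ∩ b ⊙ A ∣)) →
      ∣ A ∣ ^ 14 ≤ L ^ 4 * (S ^ 4 * (4 * S * (4 * (S + S) ^ 2) ^ 4))
    -- Each |aA ∩ bA| is at most |A| < 2^L, so L binary digits suffice; the power 2^j found becomes
    -- the threshold N.
    use (b , b∈ , n³≤) = finish (dyadic-pigeonhole A f L f (λ _ → ≤-refl)
        λ a → ≤-<-trans (≤-trans (∣p∩q∣≤∣q∣ (a ⊙ A) (b ⊙ A)) (card-⊙≤ b A)) n<2^L)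
      where
      f : Fin p → ℕ
      f a = ∣ a ⊙ A ∩ b ⊙ A ∣
      finish : (∃ λ j → sumOver A f ≤ L * (2 ^ j * ∣ superlevel A f (2 ^ j) ∣)) →
        ∣ A ∣ ^ 14 ≤ L ^ 4 * (S ^ 4 * (4 * S * (4 * (S + S) ^ 2) ^ 4))
      finish (j , le) = optimise (∣ A ∣) (2 ^ j) (∣ superlevel A f (2 ^ j) ∣) S L _ 0<A
        (p⊆q⇒∣p∣≤∣q∣ (proj₁ ∘ ∈-setOf⁻ (λ a → (a ∈? A) ×-dec (2 ^ j ≤? f a))))
        (≤-trans n³≤ (*-monoʳ-≤ S le))
        (popular-dilates A 0<A (m^n>0 2 j) (nonzero b∈) n²≤p A+A≤S)

-- The field of residues

module Residues (p : ℕ) .{{_ : NonZero p}} where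

  residue : ℕ → Fin p
  residue k = k mod p

  -- For x = 0 the representative is p itself, which `residue` sends back to 0.
  -ₚ_ : Fin p → Fin p
  -ₚ x = residue (p ∸ toℕ x)

  toℕ-residue : ∀ k → toℕ (residue k) ≡ k % p
  toℕ-residue k = toℕ-fromℕ< (m%n<n k p)

  residue-cong : ∀ {k l} → k % p ≡ l % p → residue k ≡ residue l
  residue-cong {k} {l} e = toℕ-injective (trans (toℕ-residue k) (trans e (sym (toℕ-residue l))))

  residue-toℕ : ∀ x → residue (toℕ x) ≡ x
  residue-toℕ x = toℕ-injective (trans (toℕ-residue (toℕ x)) (m<n⇒m%n≡m (toℕ<n x)))

  +ₚ-residue : ∀ k l → residue k +ₚ residue l ≡ residue (k + l)
  +ₚ-residue k l = residue-cong (trans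
    (cong₂ (λ a b → (a + b) % p) (toℕ-residue k) (toℕ-residue l)) (sym (%-distribˡ-+ k l p)))

  *ₚ-residue : ∀ k l → residue k *ₚ residue l ≡ residue (k * l)
  *ₚ-residue k l = residue-cong (trans
    (cong₂ (λ a b → (a * b) % p) (toℕ-residue k) (toℕ-residue l)) (sym (%-distribˡ-* k l p)))

  -- Every element is the residue of a natural number and `residue` respects both operations, so the
  -- ring laws are pulled back from ℕ.
  residue-elim : (P : Fin p → Set) → (∀ k → P (residue k)) → ∀ x → P x
  residue-elim P h x = subst P (residue-toℕ x) (h (toℕ x))

  +ₚ-assoc : ∀ x y z → (x +ₚ y) +ₚ z ≡ x +ₚ (y +ₚ z)
  +ₚ-assoc = residue-elim _ λ a → residue-elim _ λ b → residue-elim _ λ c → begin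
    (residue a +ₚ residue b) +ₚ residue c ≡⟨ cong (_+ₚ residue c) (+ₚ-residue a b) ⟩
    residue (a + b) +ₚ residue c ≡⟨ +ₚ-residue (a + b) c ⟩
    residue (a + b + c) ≡⟨ cong residue (+-assoc a b c) ⟩
    residue (a + (b + c)) ≡⟨ sym (+ₚ-residue a (b + c)) ⟩
    residue a +ₚ residue (b + c) ≡⟨ cong (residue a +ₚ_) (sym (+ₚ-residue b c)) ⟩
    residue a +ₚ (residue b +ₚ residue c) ∎
    where open ≡-Reasoning

  *ₚ-assoc : ∀ x y z → (x *ₚ y) *ₚ z ≡ x *ₚ (y *ₚ z)
  *ₚ-assoc = residue-elim _ λ a → residue-elim _ λ b → residue-elim _ λ c → begin
    (residue a *ₚ residue b) *ₚ residue c ≡⟨ cong (_*ₚ residue c) (*ₚ-residue a b) ⟩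
    residue (a * b) *ₚ residue c ≡⟨ *ₚ-residue (a * b) c ⟩
    residue (a * b * c) ≡⟨ cong residue (*-assoc a b c) ⟩
    residue (a * (b * c)) ≡⟨ sym (*ₚ-residue a (b * c)) ⟩
    residue a *ₚ residue (b * c) ≡⟨ cong (residue a *ₚ_) (sym (*ₚ-residue b c)) ⟩
    residue a *ₚ (residue b *ₚ residue c) ∎
    where open ≡-Reasoning

  +ₚ-comm : ∀ x y → x +ₚ y ≡ y +ₚ x
  +ₚ-comm x y = cong residue (+-comm (toℕ x) (toℕ y))

  *ₚ-comm : ∀ x y → x *ₚ y ≡ y *ₚ x
  *ₚ-comm x y = cong residue (*-comm (toℕ x) (toℕ y))

  +ₚ-identityˡ : ∀ x → residue 0 +ₚ x ≡ x
  +ₚ-identityˡ = residue-elim _ (+ₚ-residue 0)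

  *ₚ-identityˡ : ∀ x → residue 1 *ₚ x ≡ x
  *ₚ-identityˡ = residue-elim _ λ a → trans (*ₚ-residue 1 a) (cong residue (*-identityˡ a))

  -ₚ-inverseˡ : ∀ x → (-ₚ x) +ₚ x ≡ residue 0
  -ₚ-inverseˡ x = begin
    residue (p ∸ toℕ x) +ₚ x ≡⟨ cong (residue (p ∸ toℕ x) +ₚ_) (sym (residue-toℕ x)) ⟩
    residue (p ∸ toℕ x) +ₚ residue (toℕ x) ≡⟨ +ₚ-residue (p ∸ toℕ x) (toℕ x) ⟩
    residue (p ∸ toℕ x + toℕ x) ≡⟨ cong residue (m∸n+n≡m (<⇒≤ (toℕ<n x))) ⟩
    residue p ≡⟨ residue-cong (trans (n%n≡0 p) (sym (0%p≡0))) ⟩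
    residue 0 ∎
    where
    open ≡-Reasoning
    0%p≡0 : 0 % p ≡ 0
    0%p≡0 = m*n%n≡0 0 p

  *ₚ-distribˡ-+ₚ : ∀ x y z → x *ₚ (y +ₚ z) ≡ (x *ₚ y) +ₚ (x *ₚ z)
  *ₚ-distribˡ-+ₚ = residue-elim _ λ a → residue-elim _ λ b → residue-elim _ λ c → begin
    residue a *ₚ (residue b +ₚ residue c) ≡⟨ cong (residue a *ₚ_) (+ₚ-residue b c) ⟩
    residue a *ₚ residue (b + c) ≡⟨ *ₚ-residue a (b + c) ⟩
    residue (a * (b + c)) ≡⟨ cong residue (*-distribˡ-+ a b c) ⟩
    residue (a * b + a * c) ≡⟨ sym (+ₚ-residue (a * b) (a * c)) ⟩
    residue (a * b) +ₚ residue (a * c) ≡⟨ sym (cong₂ _+ₚ_ (*ₚ-residue a b) (*ₚ-residue a c)) ⟩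
    (residue a *ₚ residue b) +ₚ (residue a *ₚ residue c) ∎
    where open ≡-Reasoning

  isCommutativeRing : IsCommutativeRing _≡_ _+ₚ_ _*ₚ_ -ₚ_ (residue 0) (residue 1)
  isCommutativeRing = record
    { isRing = record
      { +-isAbelianGroup = record
        { isGroup = record
          { isMonoid = record
            { isSemigroup = record
              { isMagma = record { isEquivalence = isEquivalence ; ∙-cong = cong₂ _+ₚ_ }
              ; assoc = +ₚ-assoc
              }
            ; identity = +ₚ-identityˡ , λ x → trans (+ₚ-comm x _) (+ₚ-identityˡ x)
            }
          ; inverse = -ₚ-inverseˡ , λ x → trans (+ₚ-comm x _) (-ₚ-inverseˡ x)
          ; ⁻¹-cong = cong -ₚ_
          }
        ; comm = +ₚ-comm
        }
      ; *-cong = cong₂ _*ₚ_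
      ; *-assoc = *ₚ-assoc
      ; *-identity = *ₚ-identityˡ , λ x → trans (*ₚ-comm x _) (*ₚ-identityˡ x)
      ; distrib = *ₚ-distribˡ-+ₚ , λ x y z → trans (*ₚ-comm (y +ₚ z) x)
          (trans (*ₚ-distribˡ-+ₚ x y z) (cong₂ _+ₚ_ (*ₚ-comm x y) (*ₚ-comm x z)))
      }
    ; *-comm = *ₚ-comm
    }

  divisible⇒zero : ∀ x → p divides toℕ x → x ≡ residue 0
  divisible⇒zero x p∣x = trans (sym (residue-toℕ x)) (cong residue (small (toℕ x) (toℕ<n x) p∣x))
    where
    small : ∀ k → k < p → p divides k → k ≡ 0
    small zero _ _ = refl
    small (suc k) k<p p∣k = contradiction (∣⇒≤ p∣k) (<⇒≱ k<p)

  zeroDivisorFree : Prime p → ∀ x y → x *ₚ y ≡ residue 0 → x ≡ residue 0 ⊎ y ≡ residue 0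
  zeroDivisorFree p-prime x y e = Sum.map (divisible⇒zero x) (divisible⇒zero y)
    (euclidsLemma (toℕ x) (toℕ y) p-prime (m%n≡0⇒n∣m (toℕ x * toℕ y) p
      (trans (sym (toℕ-residue (toℕ x * toℕ y))) (trans (cong toℕ e)
        (trans (toℕ-residue 0) (m*n%n≡0 0 p))))))

  1-generates : ∀ P → residue 0 ∈ P → (∀ {x} → x ∈ P → x +ₚ residue 1 ∈ P) → ∀ x → x ∈ P
  1-generates P 0∈ step = residue-elim (_∈ P) go
    where
    go : ∀ k → residue k ∈ P
    go zero = 0∈
    go (suc k) = subst (_∈ P) (trans (+ₚ-residue k 1) (cong residue (+-comm k 1))) (step (go k))

-- Logarithms, constants and removal of zero

n≤2^⌈log₂n⌉ : ∀ n → n ≤ 2 ^ ⌈log₂ n ⌉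
n≤2^⌈log₂n⌉ = <-rec (λ n → n ≤ 2 ^ ⌈log₂ n ⌉) step
  where
  open ≤-Reasoning
  step : ∀ n → (∀ {k} → k < n → k ≤ 2 ^ ⌈log₂ k ⌉) → n ≤ 2 ^ ⌈log₂ n ⌉
  step 0 rec = z≤n
  step 1 rec = m^n>0 2 ⌈log₂ 1 ⌉
  step n@(suc (suc k)) rec = begin
    n ≡⟨ sym (⌊n/2⌋+⌈n/2⌉≡n n) ⟩
    ⌊ n /2⌋ + ⌈ n /2⌉ ≤⟨ +-monoˡ-≤ ⌈ n /2⌉ (⌊n/2⌋≤⌈n/2⌉ n) ⟩
    ⌈ n /2⌉ + ⌈ n /2⌉ ≤⟨ +-mono-≤ half half ⟩
    2 ^ (⌈log₂ n ⌉ ∸ 1) + 2 ^ (⌈log₂ n ⌉ ∸ 1)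
      ≡⟨ cong (2 ^ (⌈log₂ n ⌉ ∸ 1) +_) (sym (+-identityʳ _)) ⟩
    2 ^ suc (⌈log₂ n ⌉ ∸ 1) ≡⟨ cong (2 ^_) (m+[n∸m]≡n 1≤log) ⟩
    2 ^ ⌈log₂ n ⌉ ∎
    where
    half : ⌈ n /2⌉ ≤ 2 ^ (⌈log₂ n ⌉ ∸ 1)
    half = subst (λ l → ⌈ n /2⌉ ≤ 2 ^ l) (⌈log₂⌈n/2⌉⌉≡⌈log₂n⌉∸1 n) (rec (⌈n/2⌉<n k))
    1≤log : 1 ≤ ⌈log₂ n ⌉
    1≤log = ⌈log₂⌉-mono-≤ {2} {n} (s≤s (s≤s z≤n))

card≤suc-card-remove : ∀ {n} (A : Subset n) x → ∣ A ∣ ≤ suc ∣ A - x ∣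
card≤suc-card-remove A x = begin
  ∣ A ∣ ≤⟨ p⊆q⇒∣p∣≤∣q∣ cover ⟩
  ∣ ⁅ x ⁆ ∪ (A - x) ∣ ≤⟨ m≤m+n _ _ ⟩
  ∣ ⁅ x ⁆ ∪ (A - x) ∣ + ∣ ⁅ x ⁆ ∩ (A - x) ∣ ≡⟨ card-∪-∩ ⁅ x ⁆ (A - x) ⟩
  ∣ ⁅ x ⁆ ∣ + ∣ A - x ∣ ≡⟨ cong (_+ ∣ A - x ∣) (∣⁅x⁆∣≡1 x) ⟩
  suc ∣ A - x ∣ ∎
  where
  open ≤-Reasoning
  cover : A ⊆ ⁅ x ⁆ ∪ (A - x)
  cover {y} y∈ with y ≟ᶠ x
  ... | yes refl = x∈p∪q⁺ (inj₁ (x∈⁅x⁆ y))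
  ... | no y≢x = x∈p∪q⁺ (inj₂ (x∈p∧x≢y⇒x∈p-y y∈ y≢x))

x∉p-x : ∀ {n} (A : Subset n) x → x ∉ A - x
x∉p-x (_ ∷ A) zero ()
x∉p-x (_ ∷ A) (suc x) (there x∈) = x∉p-x A x x∈

image₂-mono : ∀ {m n k} (f : Fin m → Fin n → Fin k) {A A′ B B′} → A ⊆ A′ → B ⊆ B′ →
  image₂ f A B ⊆ image₂ f A′ B′
image₂-mono f {A} {A′} {B} {B′} A⊆ B⊆ z∈ with _ , _ , a∈ , b∈ , refl ← ∈-image₂⁻ f {A} {B} z∈ =
  ∈-image₂⁺ f {A′} {B′} (A⊆ a∈) (B⊆ b∈)

-- 2^14 pays for the removal of 0, which at most halves A; 2^4 for l + 1 ≤ 2l; and 4 · 16^4 comes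
-- from 4S(4(2S)²)⁴ = 4 · 16⁴ S⁹.
constants : ∀ n₀ n l S → n₀ ≤ 2 * n → 1 ≤ l →
  n ^ 14 ≤ suc l ^ 4 * (S ^ 4 * (4 * S * (4 * (S + S) ^ 2) ^ 4)) →
  n₀ ^ 14 ≤ 2 ^ 14 * 2 ^ 4 * (4 * 16 ^ 4) * (l ^ 4 * S ^ 13)
constants n₀ n l S n₀≤2n 1≤l n^14≤ = begin
  n₀ ^ 14 ≤⟨ ^-monoˡ-≤ 14 n₀≤2n ⟩
  (2 * n) ^ 14 ≡⟨ *-distrib-^ 2 n 14 ⟩
  2 ^ 14 * n ^ 14 ≤⟨ *-monoʳ-≤ (2 ^ 14) n^14≤ ⟩
  2 ^ 14 * (suc l ^ 4 * (S ^ 4 * (4 * S * (4 * (S + S) ^ 2) ^ 4)))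
    ≤⟨ *-monoʳ-≤ (2 ^ 14) (*-mono-≤ (^-monoˡ-≤ 4 suc-l≤2l) (≤-reflexive S-power)) ⟩
  2 ^ 14 * ((2 * l) ^ 4 * (4 * 16 ^ 4 * S ^ 13))
    ≡⟨ cong (λ t → 2 ^ 14 * (t * (4 * 16 ^ 4 * S ^ 13))) (*-distrib-^ 2 l 4) ⟩
  2 ^ 14 * (2 ^ 4 * l ^ 4 * (4 * 16 ^ 4 * S ^ 13))
    ≡⟨ eq₁ (2 ^ 14) (2 ^ 4) (l ^ 4) (4 * 16 ^ 4) (S ^ 13) ⟩
  2 ^ 14 * 2 ^ 4 * (4 * 16 ^ 4) * (l ^ 4 * S ^ 13) ∎
  where
  open ≤-Reasoning
  suc-l≤2l : suc l ≤ 2 * l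
  suc-l≤2l = +-mono-≤ 1≤l (≤-reflexive (sym (+-identityʳ l)))
  eq₁ : ∀ a b x k y → a * (b * x * (k * y)) ≡ a * b * k * (x * y)
  eq₁ = solve-∀
  eq₂ : ∀ s → 4 * ((s + s) * ((s + s) * 1)) ≡ 16 * (s * (s * 1))
  eq₂ = solve-∀
  eq₃ : ∀ x k s y → x * (4 * s * (k * y)) ≡ 4 * k * (s * (x * y))
  eq₃ = solve-∀
  S-power : S ^ 4 * (4 * S * (4 * (S + S) ^ 2) ^ 4) ≡ 4 * 16 ^ 4 * S ^ 13
  S-power = begin-equality
    S ^ 4 * (4 * S * (4 * (S + S) ^ 2) ^ 4) ≡⟨ cong (λ t → S ^ 4 * (4 * S * t ^ 4)) (eq₂ S) ⟩
    S ^ 4 * (4 * S * (16 * S ^ 2) ^ 4)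
      ≡⟨ cong (λ t → S ^ 4 * (4 * S * t))
           (trans (*-distrib-^ 16 (S ^ 2) 4) (cong (16 ^ 4 *_) (^-*-assoc S 2 4))) ⟩
    S ^ 4 * (4 * S * (16 ^ 4 * S ^ 8)) ≡⟨ eq₃ (S ^ 4) (16 ^ 4) S (S ^ 8) ⟩
    4 * 16 ^ 4 * (S * (S ^ 4 * S ^ 8)) ≡⟨ cong (λ t → 4 * 16 ^ 4 * (S * t)) (sym (^-distribˡ-+-* S 4 8)) ⟩
    4 * 16 ^ 4 * S ^ 13 ∎

theorem2p1 : Σ ℕ λ C → Σ ℕ λ α →
    (p : ℕ) .{{_ : NonZero p}} → Prime p → (A : Subset p) →
    2 ≤ ∣ A ∣ → ∣ A ∣ * ∣ A ∣ < p →
    ∣ A ∣ ^ 14 ≤ C * (⌈log₂ ∣ A ∣ ⌉ ^ α * sumProdMax A ^ 13)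
theorem2p1 = 2 ^ 14 * 2 ^ 4 * (4 * 16 ^ 4) , 4 , bound
  where
  bound : (p : ℕ) .{{_ : NonZero p}} → Prime p → (A : Subset p) →
    2 ≤ ∣ A ∣ → ∣ A ∣ * ∣ A ∣ < p →
    ∣ A ∣ ^ 14 ≤ 2 ^ 14 * 2 ^ 4 * (4 * 16 ^ 4) * (⌈log₂ ∣ A ∣ ⌉ ^ 4 * sumProdMax A ^ 13)
  bound p p-prime A 2≤A A²<p =
    constants (∣ A ∣) (∣ A* ∣) ⌈log₂ ∣ A ∣ ⌉ (sumProdMax A) A≤2A* (⌈log₂⌉-mono-≤ 2≤A)
      (sum-product A* (suc ⌈log₂ ∣ A ∣ ⌉) 0<A*
        (λ a∈ a≡0 → x∉p-x A (residue 0) (subst (_∈ A*) a≡0 a∈))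
        (≤-trans (*-mono-≤ A*≤A A*≤A) (<⇒≤ A²<p))
        A*<2^L
        (≤-trans (p⊆q⇒∣p∣≤∣q∣ (image₂-mono _+ₚ_ {A*} {A} {A*} {A} A*⊆A A*⊆A))
          (m≤n⊔m ∣ prodset A ∣ ∣ sumset A ∣))
        (≤-trans (p⊆q⇒∣p∣≤∣q∣ (image₂-mono _*ₚ_ {A*} {A} {A*} {A} A*⊆A A*⊆A))
          (m≤m⊔n ∣ prodset A ∣ ∣ sumset A ∣)))
    where
    open Residues p
    open SumProduct _+ₚ_ _*ₚ_ -ₚ_ (residue 0) (residue 1) isCommutativeRing
      (zeroDivisorFree p-prime) 1-generates
    -- Dilation by 0 would collapse A to a point, so 0 is taken out; as |A| ≥ 2, at least half of A
    -- remains.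
    A* : Subset p
    A* = A - residue 0
    A*⊆A : A* ⊆ A
    A*⊆A = p─q⊆p A ⁅ residue 0 ⁆
    A*≤A : ∣ A* ∣ ≤ ∣ A ∣
    A*≤A = p⊆q⇒∣p∣≤∣q∣ A*⊆A
    A≤1+A* : ∣ A ∣ ≤ suc ∣ A* ∣
    A≤1+A* = card≤suc-card-remove A (residue 0)
    0<A* : 0 < ∣ A* ∣
    0<A* = ≤-pred (≤-trans 2≤A A≤1+A*)
    A≤2A* : ∣ A ∣ ≤ 2 * ∣ A* ∣
    A≤2A* = ≤-trans A≤1+A* (+-mono-≤ 0<A* (≤-reflexive (sym (+-identityʳ ∣ A* ∣))))
    -- The extra 1 makes the bound strict when |A| is itself a power of 2.
    A*<2^L : ∣ A* ∣ < 2 ^ suc ⌈log₂ ∣ A ∣ ⌉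
    A*<2^L = ≤-<-trans (≤-trans A*≤A (n≤2^⌈log₂n⌉ ∣ A ∣))
      (^-monoʳ-< 2 (s≤s (s≤s z≤n)) (n<1+n ⌈log₂ ∣ A ∣ ⌉))
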